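{- For $n,k\ge1$, \[ d(n,k)=\sum_{r=2}^k \sum_{\ell=1}^r \sum_{r_1+ \dots +r_{\ell}=r} \sum_{\substack{n_1< \cdots <n_{\ell} \\ r_1n_1+ \cdots +r_{\ell}n_{\ell}=n}} \sum_{\substack{k_1+ \cdots +k_{\ell}=k\\k_i \geq r_i}}\left( \binom{r}{r_1,r_2,\dots,r_{\ell}} \prod_{i=1}^\ell \sum_{k_{i_1}+ \cdots +k_{i_{r_i}}=k_i} \prod_{t=1}^{r_i}c(n_i,k_{i_t})\right), \] where all summation variables $r_i,n_i,k_i,k_{i_t}$ are positive integers and $\binom{r}{r_1,\dots,r_\ell}$ is the multinomial coefficient.
   Context: For a permutation $\pi$ of $[n]=\{1,\dots,n\}$ (one-line notation $[\pi(1),\dots,\pi(n)]$), the permutation graph $G_\pi$ has vertex set $[n]$ and an edge between $i<j$ iff $\pi^{ -1}(i)>\pi^{ -1}(j)$. The domination number is the minimum size of a set $D$ of vertices such that every vertex is in $D$ or adjacent to a vertex of $D$. $c(n,k)$ denotes the number of permutations $\pi\in S_n$ such that $G_\pi$ is connected and has domination number $k$, and $d(n,k)$ denotes the number of permutations $\pi\in S_n$ such that $G_\pi$ is disconnected and has domination number $k$. -}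

module Defs where

open import Data.Bool using (Bool; true; false; _∧_; _∨_; not; if_then_else_)
open import Data.Nat using (ℕ; zero; suc; _+_; _*_; _∸_; _⊓_; _≤ᵇ_; _<ᵇ_; _≡ᵇ_)
open import Data.Nat.Combinatorics using (_C_)
open import Data.Fin using (Fin; toℕ)
open import Data.List using (List; []; _∷_; map; concatMap; filterᵇ; length; allFin; upTo; foldr)
open import Data.Nat.ListAction using (sum; product)
open import Data.Bool.ListAction using (any; all)
open import Data.Vec using (Vec; []; _∷_; lookup; toList)

vecsOver : {A : Set} (m : ℕ) → List A → List (Vec A m)
vecsOver zero    xs = [] ∷ []
vecsOver (suc m) xs = concatMap (λ x → map (x ∷_) (vecsOver m xs)) xs

interval : ℕ → ℕ → List ℕ
interval a b = map (a +_) (upTo (suc b ∸ a))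

box : (ℓ b : ℕ) → List (Vec ℕ ℓ)
box ℓ b = vecsOver ℓ (interval 1 b)

sumOver : {A : Set} → List A → (A → Bool) → (A → ℕ) → ℕ
sumOver xs p f = sum (map f (filterᵇ p xs))

vsum : {m : ℕ} → Vec ℕ m → ℕ
vsum v = sum (toList v)

vprod : {m : ℕ} → Vec ℕ m → ℕ
vprod v = product (toList v)

dot : {m : ℕ} → Vec ℕ m → Vec ℕ m → ℕ
dot []       []       = 0
dot (x ∷ xs) (y ∷ ys) = x * y + dot xs ys

strictlyIncreasing : {m : ℕ} → Vec ℕ m → Bool
strictlyIncreasing []           = true
strictlyIncreasing (x ∷ [])     = true
strictlyIncreasing (x ∷ y ∷ xs) = (x <ᵇ y) ∧ strictlyIncreasing (y ∷ xs)

pointwiseGeq : {m : ℕ} → Vec ℕ m → Vec ℕ m → Bool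
pointwiseGeq []       []       = true
pointwiseGeq (k ∷ ks) (r ∷ rs) = (r ≤ᵇ k) ∧ pointwiseGeq ks rs

multinomial : {m : ℕ} → Vec ℕ m → ℕ
multinomial []       = 1
multinomial (r ∷ rs) = ((r + vsum rs) C r) * multinomial rs

_==ᶠ_ : {n : ℕ} → Fin n → Fin n → Bool
i ==ᶠ j = toℕ i ≡ᵇ toℕ j

_<ᶠ_ : {n : ℕ} → Fin n → Fin n → Bool
i <ᶠ j = toℕ i <ᵇ toℕ j

-- one-line notation: π is the vector [π(1), …, π(n)] (0-indexed Fin n)
injective : {n : ℕ} → Vec (Fin n) n → Bool
injective {n} π =
  all (λ p → all (λ q → (p ==ᶠ q) ∨ not (lookup π p ==ᶠ lookup π q)) (allFin n)) (allFin n)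

perms : (n : ℕ) → List (Vec (Fin n) n)
perms n = filterᵇ injective (vecsOver n (allFin n))

isInv : {n : ℕ} → Vec (Fin n) n → Fin n → Fin n → Bool
isInv π i p = lookup π p ==ᶠ i

edgeOrd : {n : ℕ} → Vec (Fin n) n → Fin n → Fin n → Bool
edgeOrd {n} π i j = (i <ᶠ j) ∧
  any (λ p → any (λ q → isInv π i p ∧ isInv π j q ∧ (q <ᶠ p)) (allFin n)) (allFin n)

adj : {n : ℕ} → Vec (Fin n) n → Fin n → Fin n → Bool
adj π i j = edgeOrd π i j ∨ edgeOrd π j i

walkWithin : {n : ℕ} → Vec (Fin n) n → ℕ → Fin n → Fin n → Bool
walkWithin π zero    i j = i ==ᶠ j
walkWithin {n} π (suc t) i j =
  walkWithin π t i j ∨ any (λ m → walkWithin π t i m ∧ adj π m j) (allFin n)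

-- G_π connected: every two vertices are joined by a walk
-- (a walk exists iff one of length ≤ n exists)
connected : {n : ℕ} → Vec (Fin n) n → Bool
connected {n} π = all (λ i → all (λ j → walkWithin π n i j) (allFin n)) (allFin n)

subsets : (n : ℕ) → List (Vec Bool n)
subsets n = vecsOver n (true ∷ false ∷ [])

size : {n : ℕ} → Vec Bool n → ℕ
size []           = 0
size (true ∷ s)   = suc (size s)
size (false ∷ s)  = size s

dominating : {n : ℕ} → Vec (Fin n) n → Vec Bool n → Bool
dominating {n} π D =
  all (λ v → lookup D v ∨ any (λ u → lookup D u ∧ adj π u v) (allFin n)) (allFin n)

-- minimum size of a dominating set (the full vertex set, of size n,
-- is always dominating, so n is a valid initial bound)
dominationNumber : {n : ℕ} → Vec (Fin n) n → ℕ
dominationNumber {n} π =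
  foldr (λ D acc → if dominating π D then size D ⊓ acc else acc) n (subsets n)

c : ℕ → ℕ → ℕ
c n k = length (filterᵇ (λ π → connected π ∧ (dominationNumber π ≡ᵇ k)) (perms n))

d : ℕ → ℕ → ℕ
d n k = length (filterᵇ (λ π → not (connected π) ∧ (dominationNumber π ≡ᵇ k)) (perms n))

inner : (rᵢ nᵢ kᵢ : ℕ) → ℕ
inner rᵢ nᵢ kᵢ = sumOver (box rᵢ kᵢ) (λ kk → vsum kk ≡ᵇ kᵢ) (λ kk → vprod (Data.Vec.map (c nᵢ) kk))

prodInner : {m : ℕ} → Vec ℕ m → Vec ℕ m → Vec ℕ m → ℕ
prodInner []       []       []       = 1
prodInner (r ∷ rs) (n ∷ ns) (k ∷ ks) = inner r n k * prodInner rs ns ks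

rhs : ℕ → ℕ → ℕ
rhs n k =
  sum (map (λ r →
    sum (map (λ ℓ →
      sumOver (box ℓ r) (λ rs → vsum rs ≡ᵇ r) (λ rs →
        sumOver (box ℓ n) (λ ns → strictlyIncreasing ns ∧ (dot rs ns ≡ᵇ n)) (λ ns →
          sumOver (box ℓ k) (λ ks → (vsum ks ≡ᵇ k) ∧ pointwiseGeq ks rs) (λ ks →
            multinomial rs * prodInner rs ns ks))))
    (interval 1 r)))
  (interval 2 k))

-- Let C, D and A be the generating functions, in x for the size and y for the domination
-- number, of the connected, the disconnected and all nonempty permutations.  A permutation
-- is disconnected exactly when it maps a proper nonempty initial segment onto itself; cutting at the
-- shortest such segment writes it uniquely as a direct sum σ ⊕ τ with σ connected.
-- Domination numbers add up over direct sums, so D = C A = C (C + D) = C² + C³ + ⋯, and the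
-- coefficient of yᵏ only receives contributions from Cʳ with r ≤ k.  Expanding
-- Cʳ = (Σ c(m, –) xᵐ)ʳ by the multinomial theorem groups the components by size; the sums
-- over the kᵢ and the kᵢₜ compute the coefficient of yᵏ in the product of the c(nᵢ, –)^rᵢ.

module Submission where

open import Defs
open import Data.Nat using (ℕ; _≤_)
open import Relation.Binary.PropositionalEquality using (_≡_)

-- The coefficients form only a semiring, so D = C² + C D is not solved by dividing by 1 - C: it is
-- unrolled finitely often. After k steps the remainder Cᵏ D is divisible by y to the power k + 2,
-- because a nonempty graph has positive domination number; the same divisibility accounts for the
-- constraint kᵢ ≥ rᵢ. The bijection behind the direct sum decomposition is never built. Counts are
-- sums of indicators over all vectors, and such a sum factors along `_⊕_` as soon as its summand
-- vanishes off the vectors with the given block. The graph-theoretic core is that a permutation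
-- without a proper block has a connected graph: at every cut some inversion spans the two vertices
-- next to it, and a vertex set closed under adjacency cannot tell these two apart. Expanding over
-- strictly increasing sizes is done by removing the smallest size, which reduces the multinomial
-- theorem to a telescoping use of the binomial theorem.

module PermutationGraphs where
  open import Data.Bool using (Bool; true; false; _∧_; _∨_; not; T; if_then_else_)
  import Data.Bool.Properties as 𝔹ₚ
  open import Data.Bool.ListAction using (any; all)
  open import Data.Empty using (⊥-elim)
  open import Data.Fin as Fin using (Fin; zero; suc; toℕ; fromℕ<; _↑ˡ_; _↑ʳ_; splitAt; punchOut)
  import Data.Fin.Properties as Finₚ
  import Data.Fin.Subset as Subset
  import Data.Fin.Subset.Properties as Subsetₚ
  open import Data.List using (List; []; _∷_; allFin; foldr; map)
  open import Data.List.Membership.Propositional using (_∈_; lose; find)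
  open import Data.List.Membership.Propositional.Properties using (∈-allFin; ∈-map⁺; ∈-concatMap⁺)
  import Data.List.Relation.Unary.All as LAll
  import Data.List.Relation.Unary.All.Properties as LAllₚ
  open import Data.List.Relation.Unary.Any using (here; there)
  import Data.List.Relation.Unary.Any.Properties as LAnyₚ
  open import Data.Nat as ℕ using (zero; suc; _+_; _⊓_; _<_; _<ᵇ_; z≤n; s≤s)
  import Data.Nat.Properties as ℕₚ
  open import Data.Product using (∃; ∃₂; _×_; _,_; proj₁; proj₂)
  open import Data.Sum as Sum using (_⊎_; inj₁; inj₂)
  open import Data.Unit using (tt)
  open import Data.Vec as Vec using (Vec; []; _∷_; lookup; _++_; tabulate; replicate)
  import Data.Vec.Properties as Vecₚ
  open import Function using (_∘_; Equivalence)
  open import Relation.Binary.PropositionalEquality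
    using (_≢_; refl; sym; trans; cong; cong₂; subst; subst₂)
  open import Relation.Nullary using (¬_; yes; no; Dec; does; contradiction)
  open import Relation.Nullary.Decidable using (_×-dec_; ¬?; decidable-stable)

  -- Boolean tests and the propositions they decide

  module _ {n} {p : Fin n → Bool} where

    all⇒ : T (all p (allFin n)) → ∀ i → T (p i)
    all⇒ t i = LAll.lookup (LAllₚ.all⁺ p (allFin n) t) (∈-allFin i)

    all⇐ : (∀ i → T (p i)) → T (all p (allFin n))
    all⇐ f = LAllₚ.all⁻ p (LAll.tabulate {xs = allFin n} λ {i} _ → f i)

    any⇒ : T (any p (allFin n)) → ∃ λ i → T (p i)
    any⇒ t with i , _ , pi ← find (LAnyₚ.any⁻ p (allFin n) t) = i , pi

    any⇐ : ∀ i → T (p i) → T (any p (allFin n))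
    any⇐ i pi = LAnyₚ.any⁺ p (lose (∈-allFin i) pi)

  ∧⇒ : ∀ {a b} → T (a ∧ b) → T a × T b
  ∧⇒ = Equivalence.to 𝔹ₚ.T-∧

  ∧⇐ : ∀ {a b} → T a → T b → T (a ∧ b)
  ∧⇐ ta tb = Equivalence.from 𝔹ₚ.T-∧ (ta , tb)

  ∨⇒ : ∀ {a b} → T (a ∨ b) → T a ⊎ T b
  ∨⇒ = Equivalence.to 𝔹ₚ.T-∨

  ∨⇐ : ∀ {a b} → T a ⊎ T b → T (a ∨ b)
  ∨⇐ = Equivalence.from 𝔹ₚ.T-∨

  T⇒true : ∀ {b} → T b → b ≡ true
  T⇒true = Equivalence.to 𝔹ₚ.T-≡

  true⇒T : ∀ {b} → b ≡ true → T b
  true⇒T = Equivalence.from 𝔹ₚ.T-≡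

  ¬T⇒false : ∀ {b} → ¬ T b → b ≡ false
  ¬T⇒false {true}  ¬t = ⊥-elim (¬t tt)
  ¬T⇒false {false} _  = refl

  bool-ext : ∀ {a b} → (T a → T b) → (T b → T a) → a ≡ b
  bool-ext {true}  {true}  _ _ = refl
  bool-ext {true}  {false} f _ = ⊥-elim (f tt)
  bool-ext {false} {true}  _ g = ⊥-elim (g tt)
  bool-ext {false} {false} _ _ = refl

  <ᵇ-true : ∀ {m n} → m < n → (m <ᵇ n) ≡ true
  <ᵇ-true = T⇒true ∘ ℕₚ.<⇒<ᵇ

  <ᵇ-false : ∀ {m n} → n ≤ m → (m <ᵇ n) ≡ false
  <ᵇ-false n≤m = ¬T⇒false λ t → ℕₚ.≤⇒≯ n≤m (ℕₚ.<ᵇ⇒< _ _ t)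

  <ᵇ-true⇒< : ∀ {m n} → (m <ᵇ n) ≡ true → m < n
  <ᵇ-true⇒< eq = ℕₚ.<ᵇ⇒< _ _ (true⇒T eq)

  <ᵇ-false⇒≥ : ∀ {m n} → (m <ᵇ n) ≡ false → n ≤ m
  <ᵇ-false⇒≥ {m} {n} eq = ℕₚ.≮⇒≥ λ m<n → contradiction (trans (sym eq) (<ᵇ-true m<n)) λ ()

  ==ᶠ⇒≡ : ∀ {n} {i j : Fin n} → T (i ==ᶠ j) → i ≡ j
  ==ᶠ⇒≡ t = Finₚ.toℕ-injective (ℕₚ.≡ᵇ⇒≡ _ _ t)

  ≡⇒==ᶠ : ∀ {n} {i j : Fin n} → i ≡ j → T (i ==ᶠ j)
  ≡⇒==ᶠ {i = i} refl = ℕₚ.≡⇒≡ᵇ (toℕ i) (toℕ i) refl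

  Inj : ∀ {m n} → Vec (Fin n) m → Set
  Inj v = ∀ {p q} → lookup v p ≡ lookup v q → p ≡ q

  injective⇒Inj : ∀ {n} (v : Vec (Fin n) n) → T (injective v) → Inj v
  injective⇒Inj v t {p} {q} eq with ∨⇒ (all⇒ (all⇒ t p) q)
  ... | inj₁ e = ==ᶠ⇒≡ e
  ... | inj₂ e = ⊥-elim (subst T (cong not (T⇒true (≡⇒==ᶠ eq))) e)

  Inj⇒injective : ∀ {n} {v : Vec (Fin n) n} → Inj v → T (injective v)
  Inj⇒injective {v = v} inj = all⇐ λ p → all⇐ λ q → ∨⇐ (lemma p q)
    where
    lemma : ∀ p q → T (p ==ᶠ q) ⊎ T (not (lookup v p ==ᶠ lookup v q))
    lemma p q with lookup v p ==ᶠ lookup v q in eq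
    ... | false = inj₂ tt
    ... | true  = inj₁ (≡⇒==ᶠ (inj (==ᶠ⇒≡ (true⇒T eq))))

  EdgeOrd : ∀ {n} → Vec (Fin n) n → Fin n → Fin n → Set
  EdgeOrd v i j = i Fin.< j × ∃₂ λ p q → lookup v p ≡ i × lookup v q ≡ j × q Fin.< p

  Adj : ∀ {n} → Vec (Fin n) n → Fin n → Fin n → Set
  Adj v i j = EdgeOrd v i j ⊎ EdgeOrd v j i

  module _ {n} (v : Vec (Fin n) n) where

    edgeOrd⇒ : ∀ {i j} → T (edgeOrd v i j) → EdgeOrd v i j
    edgeOrd⇒ t with i<j , s ← ∧⇒ t with p , s ← any⇒ s with q , s ← any⇒ s
               with a , s ← ∧⇒ s with b , q<p ← ∧⇒ s =
      ℕₚ.<ᵇ⇒< _ _ i<j , p , q , ==ᶠ⇒≡ a , ==ᶠ⇒≡ b , ℕₚ.<ᵇ⇒< _ _ q<p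

    edgeOrd⇐ : ∀ {i j} → EdgeOrd v i j → T (edgeOrd v i j)
    edgeOrd⇐ (i<j , p , q , a , b , q<p) =
      ∧⇐ (ℕₚ.<⇒<ᵇ i<j) (any⇐ p (any⇐ q (∧⇐ (≡⇒==ᶠ a) (∧⇐ (≡⇒==ᶠ b) (ℕₚ.<⇒<ᵇ q<p)))))

    adj⇒ : ∀ {i j} → T (adj v i j) → Adj v i j
    adj⇒ t with ∨⇒ t
    ... | inj₁ e = inj₁ (edgeOrd⇒ e)
    ... | inj₂ e = inj₂ (edgeOrd⇒ e)

    adj⇐ : ∀ {i j} → Adj v i j → T (adj v i j)
    adj⇐ (inj₁ e) = ∨⇐ (inj₁ (edgeOrd⇐ e))
    adj⇐ (inj₂ e) = ∨⇐ (inj₂ (edgeOrd⇐ e))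

  walk-suc⇒ : ∀ {n} (v : Vec (Fin n) n) t {i j} → T (walkWithin v (suc t) i j) →
    T (walkWithin v t i j) ⊎ ∃ λ x → T (walkWithin v t i x) × Adj v x j
  walk-suc⇒ v t {i} {j} w with ∨⇒ {walkWithin v t i j} w
  ... | inj₁ w′ = inj₁ w′
  ... | inj₂ s with x , s′ ← any⇒ {p = λ x → walkWithin v t i x ∧ adj v x j} s
               with w′ , e ← ∧⇒ {walkWithin v t i x} s′ = inj₂ (x , w′ , adj⇒ v e)

  -- Blocks (invariant initial segments) and connectedness

  Block : ∀ {n} → Vec (Fin n) n → ℕ → Set
  Block v m = ∀ p → (toℕ p <ᵇ m) ≡ (toℕ (lookup v p) <ᵇ m)

  block? : ∀ {n} (v : Vec (Fin n) n) m → Dec (Block v m)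
  block? v m = Finₚ.all? λ p → (toℕ p <ᵇ m) 𝔹ₚ.≟ (toℕ (lookup v p) <ᵇ m)

  block : ∀ {n} → Vec (Fin n) n → ℕ → Bool
  block v m = does (block? v m)

  module _ {n} {v : Vec (Fin n) n} {m} (blk : Block v m) where

    private
      -- An edge is an inversion. Were its smaller value below the cut and its larger one above, the
      -- block would put their positions in the same order, so they would not be inverted.
      edge-side : ∀ {i j} → EdgeOrd v i j → (toℕ i <ᵇ m) ≡ (toℕ j <ᵇ m)
      edge-side {i} {j} (i<j , p , q , refl , refl , q<p)
        with toℕ i <ᵇ m in a | toℕ j <ᵇ m in b
      ... | true  | true  = refl
      ... | false | false = refl
      ... | false | true  = ⊥-elim (ℕₚ.<-asym i<j (ℕₚ.<-≤-trans (<ᵇ-true⇒< {n = m} b) (<ᵇ-false⇒≥ {n = m} a)))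
      ... | true  | false = ⊥-elim (ℕₚ.<-asym q<p (ℕₚ.<-≤-trans
        (<ᵇ-true⇒< {n = m} (trans (blk p) a)) (<ᵇ-false⇒≥ {n = m} (trans (blk q) b))))

    adj-side : ∀ {i j} → Adj v i j → (toℕ i <ᵇ m) ≡ (toℕ j <ᵇ m)
    adj-side (inj₁ e) = edge-side e
    adj-side (inj₂ e) = sym (edge-side e)

    walk-side : ∀ t {i j} → T (walkWithin v t i j) → (toℕ i <ᵇ m) ≡ (toℕ j <ᵇ m)
    walk-side zero w = cong (λ x → toℕ x <ᵇ m) (==ᶠ⇒≡ w)
    walk-side (suc t) w with walk-suc⇒ v t w
    ... | inj₁ w′           = walk-side t w′
    ... | inj₂ (x , w′ , e) = trans (walk-side t w′) (adj-side e)

  -- Vertices 0 and m lie on opposite sides of the cut, and walks never change sides. The bounds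
  -- exclude m = 0 and m ≥ n, which are blocks of every vector.
  block⇒¬connected : ∀ {n} {v : Vec (Fin n) n} {m} → 0 < m → m < n → Block v m → ¬ T (connected v)
  block⇒¬connected {suc n} {v} {m} 0<m m<n blk conn =
    contradiction (trans (sym (<ᵇ-true 0<m)) (trans side (<ᵇ-false m≤))) λ ()
    where
    m≤ : m ≤ toℕ (fromℕ< m<n)
    m≤ = ℕₚ.≤-reflexive (sym (Finₚ.toℕ-fromℕ< m<n))
    side : (0 <ᵇ m) ≡ (toℕ (fromℕ< m<n) <ᵇ m)
    side = walk-side {m = m} blk (suc n) (all⇒ {p = λ j → walkWithin v (suc n) zero j}
      (all⇒ {p = λ i → all (λ j → walkWithin v (suc n) i j) (allFin (suc n))} conn zero) (fromℕ< m<n))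

  -- A missed value x could be punched out of the target, leaving an injection from n + 1 positions
  -- into n values.
  Inj⇒surjective : ∀ {n} (v : Vec (Fin n) n) → Inj v → ∀ x → ∃ λ p → lookup v p ≡ x
  Inj⇒surjective {suc n} v inj x with Finₚ.any? (λ p → lookup v p Finₚ.≟ x)
  ... | yes hit = hit
  ... | no  miss = ⊥-elim (ℕₚ.1+n≰n (Finₚ.injective⇒≤
    {f = λ p → punchOut {i = x} {j = lookup v p} (λ eq → miss (p , sym eq))}
    λ eq → inj (Finₚ.punchOut-injective (λ e → miss (_ , sym e)) (λ e → miss (_ , sym e)) eq)))

  -- The positions `A t` together with x would be a + 1 positions sent injectively into the a values
  -- `A s`. Applied below with `A` either side of a cut.
  no-intruder : ∀ {n a} (v : Vec (Fin n) n) → Inj v →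
    (A : Fin a → Fin n) → (∀ {s t} → A s ≡ A t → s ≡ t) → (∀ t → ∃ λ s → lookup v (A t) ≡ A s) →
    ∀ x → (∀ t → A t ≢ x) → ∀ s → lookup v x ≢ A s
  no-intruder {n} {a} v inj A A-inj stays x x∉A s eq
    with i , j , i<j , gi≡gj ← Finₚ.pigeonhole (ℕₚ.n<1+n a) (λ { zero → s ; (suc t) → proj₁ (stays t) })
    with i | j | i<j
  ... | zero  | suc t  | _ = x∉A t (inj (trans (proj₂ (stays t)) (trans (cong A (sym gi≡gj)) (sym eq))))
  ... | suc t | suc t′ | s≤s t<t′ = ℕₚ.<-irrefl (cong toℕ (A-inj (inj (trans (proj₂ (stays t))
          (trans (cong A gi≡gj) (sym (proj₂ (stays t′)))))))) t<t′
  ... | _ | zero | ()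

  <ᵇ-↑ˡ : ∀ {m} (i : Fin m) p → (toℕ (i ↑ˡ p) <ᵇ m) ≡ true
  <ᵇ-↑ˡ {m} i p = <ᵇ-true (subst (_< m) (sym (Finₚ.toℕ-↑ˡ i p)) (Finₚ.toℕ<n i))

  <ᵇ-↑ʳ : ∀ m {p} (i : Fin p) → (toℕ (m ↑ʳ i) <ᵇ m) ≡ false
  <ᵇ-↑ʳ m i = <ᵇ-false (subst (m ≤_) (sym (Finₚ.toℕ-↑ʳ m i)) (ℕₚ.m≤m+n m (toℕ i)))

  data Side m p : Fin (m + p) → Set where
    left  : ∀ i → Side m p (i ↑ˡ p)
    right : ∀ i → Side m p (m ↑ʳ i)

  side : ∀ m p x → Side m p x
  side m p x with splitAt m x in eq
  ... | inj₁ i = subst (Side m p) (Finₚ.splitAt⁻¹-↑ˡ eq) (left i)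
  ... | inj₂ i = subst (Side m p) (Finₚ.splitAt⁻¹-↑ʳ eq) (right i)

  <ᵇ⇒left : ∀ m {p} {x : Fin (m + p)} → (toℕ x <ᵇ m) ≡ true → ∃ λ i → x ≡ i ↑ˡ p
  <ᵇ⇒left m {p} {x} eq with side m p x
  ... | left i  = i , refl
  ... | right i = contradiction (trans (sym eq) (<ᵇ-↑ʳ m i)) λ ()

  ≮ᵇ⇒right : ∀ m {p} {x : Fin (m + p)} → (toℕ x <ᵇ m) ≡ false → ∃ λ i → x ≡ m ↑ʳ i
  ≮ᵇ⇒right m {p} {x} eq with side m p x
  ... | left i  = contradiction (trans (sym (<ᵇ-↑ˡ i p)) eq) λ ()
  ... | right i = i , refl

  left≢right : ∀ {m p} {i : Fin m} {j : Fin p} → i ↑ˡ p ≢ m ↑ʳ j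
  left≢right {m} {p} {i} {j} eq =
    contradiction (trans (sym (<ᵇ-↑ˡ i p)) (trans (cong (λ x → toℕ x <ᵇ m) eq) (<ᵇ-↑ʳ m j))) λ ()

  -- By pigeonhole, a cut crossed in one direction is crossed in the other one too.
  crossing : ∀ {n m} → m ≤ n → (v : Vec (Fin n) n) → Inj v → ¬ Block v m →
    (∃ λ q → (toℕ q <ᵇ m) ≡ true × (toℕ (lookup v q) <ᵇ m) ≡ false) ×
    (∃ λ q → (toℕ q <ᵇ m) ≡ false × (toℕ (lookup v q) <ᵇ m) ≡ true)
  crossing {n} {m} m≤n v inj ¬blk with p , refl ← ℕₚ.m≤n⇒∃[o]m+o≡n m≤n
    with Finₚ.any? (λ q → ((toℕ q <ᵇ m) 𝔹ₚ.≟ true) ×-dec ((toℕ (lookup v q) <ᵇ m) 𝔹ₚ.≟ false))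
       | Finₚ.any? (λ q → ((toℕ q <ᵇ m) 𝔹ₚ.≟ false) ×-dec ((toℕ (lookup v q) <ᵇ m) 𝔹ₚ.≟ true))
  ... | yes up | yes down = up , down
  ... | no ¬up | no ¬down = ⊥-elim (¬blk λ q → lemma q)
    where
    lemma : ∀ q → (toℕ q <ᵇ m) ≡ (toℕ (lookup v q) <ᵇ m)
    lemma q with toℕ q <ᵇ m in a | toℕ (lookup v q) <ᵇ m in b
    ... | true  | true  = refl
    ... | false | false = refl
    ... | true  | false = ⊥-elim (¬up (q , a , b))
    ... | false | true  = ⊥-elim (¬down (q , a , b))
  ... | yes (q , a , b) | no ¬down = ⊥-elim (no-intruder v inj
      (m ↑ʳ_) (λ {s} {t} → Finₚ.↑ʳ-injective m s t) stays q
      (λ t eq → contradiction (trans (sym a) (trans (cong (λ x → toℕ x <ᵇ m) (sym eq)) (<ᵇ-↑ʳ m t))) λ ())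
      (proj₁ (≮ᵇ⇒right m b)) (proj₂ (≮ᵇ⇒right m b)))
    where
    stays : ∀ t → ∃ λ s → lookup v (m ↑ʳ t) ≡ m ↑ʳ s
    stays t = ≮ᵇ⇒right m (𝔹ₚ.¬-not λ eq → ¬down (m ↑ʳ t , <ᵇ-↑ʳ m t , eq))
  ... | no ¬up | yes (q , a , b) = ⊥-elim (no-intruder v inj
      (_↑ˡ p) (λ {s} {t} → Finₚ.↑ˡ-injective p s t) stays q
      (λ t eq → contradiction (trans (sym a) (trans (cong (λ x → toℕ x <ᵇ m) (sym eq)) (<ᵇ-↑ˡ t p))) λ ())
      (proj₁ (<ᵇ⇒left m b)) (proj₂ (<ᵇ⇒left m b)))
    where
    stays : ∀ t → ∃ λ s → lookup v (t ↑ˡ p) ≡ s ↑ˡ p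
    stays t = <ᵇ⇒left m (𝔹ₚ.¬-not λ eq → ¬up (t ↑ˡ p , <ᵇ-↑ˡ t p , eq))

  Closed : ∀ {n} → Vec (Fin n) n → (Fin n → Bool) → Set
  Closed v S = ∀ {i j} → Adj v i j → T (S i) → T (S j)

  module _ {n} (v : Vec (Fin n) n) (inj : Inj v) {S : Fin n → Bool} (closed : Closed v S) where

    private
      adj-≡ : ∀ {i j} → Adj v i j → S i ≡ S j
      adj-≡ e = bool-ext (closed e) (closed (Sum.swap e))

    -- Every vertex strictly between the ends of an edge is adjacent to one of them.
    sandwich : ∀ {i j x} → EdgeOrd v i j → i Fin.≤ x → x Fin.≤ j → S x ≡ S i
    sandwich {i} {j} {x} e@(_ , p , q , vp , vq , q<p) i≤x x≤j with ℕₚ.m≤n⇒m<n∨m≡n i≤x | ℕₚ.m≤n⇒m<n∨m≡n x≤j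
    ... | inj₂ i≡x | _ = cong S (sym (Finₚ.toℕ-injective i≡x))
    ... | inj₁ _   | inj₂ x≡j = trans (cong S (Finₚ.toℕ-injective x≡j)) (sym (adj-≡ (inj₁ e)))
    ... | inj₁ i<x | inj₁ x<j with s , vs ← Inj⇒surjective v inj x with ℕ._<?_ (toℕ s) (toℕ p)
    ...   | yes s<p = sym (adj-≡ (inj₁ (i<x , p , s , vp , vs , s<p)))
    ...   | no  s≮p = trans (adj-≡ (inj₁ (x<j , s , q , vs , vq , ℕₚ.<-≤-trans q<p (ℕₚ.≮⇒≥ s≮p))))
                            (sym (adj-≡ (inj₁ e)))

    -- The cut between x and y is crossed both ways: a value below it sits at a position beyond it,
    -- and a value beyond it at a position below it. These two values are inverted, hence form an
    -- edge spanning x and y, and `sandwich` gives `S` the same value at x and y as at the lower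
    -- end.
    step-≡ : (x y : Fin n) → toℕ y ≡ suc (toℕ x) → ¬ Block v (toℕ y) → S x ≡ S y
    step-≡ x y y≡1+x ¬blk = trans (sandwich e (ℕₚ.≤-pred (subst (toℕ (lookup v p′) <_) y≡1+x a<)) x≤b)
                                  (sym (sandwich e (ℕₚ.<⇒≤ a<) ≤b))
      where
      m = toℕ y
      crosses : (∃ λ q → (toℕ q <ᵇ m) ≡ true × (toℕ (lookup v q) <ᵇ m) ≡ false) ×
                (∃ λ q → (toℕ q <ᵇ m) ≡ false × (toℕ (lookup v q) <ᵇ m) ≡ true)
      crosses = crossing (ℕₚ.<⇒≤ (Finₚ.toℕ<n y)) v inj ¬blk
      q′ p′ : Fin n
      q′ = proj₁ (proj₁ crosses)
      p′ = proj₁ (proj₂ crosses)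
      a< : toℕ (lookup v p′) < m
      a< = <ᵇ-true⇒< (proj₂ (proj₂ (proj₂ crosses)))
      ≤b : m ≤ toℕ (lookup v q′)
      ≤b = <ᵇ-false⇒≥ (proj₂ (proj₂ (proj₁ crosses)))
      x≤b : toℕ x ≤ toℕ (lookup v q′)
      x≤b = ℕₚ.≤-trans (ℕₚ.n≤1+n _) (subst (_≤ toℕ (lookup v q′)) y≡1+x ≤b)
      e : EdgeOrd v (lookup v p′) (lookup v q′)
      e = ℕₚ.<-≤-trans a< ≤b , p′ , q′ , refl , refl ,
          ℕₚ.<-≤-trans (<ᵇ-true⇒< {n = m} (proj₁ (proj₂ (proj₁ crosses))))
            (<ᵇ-false⇒≥ {n = m} (proj₁ (proj₂ (proj₂ crosses))))

    constant : (∀ m → 0 < m → m < n → ¬ Block v m) → ∀ x y → S x ≡ S y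
    constant ¬blk x y = trans (from-start (toℕ x) x refl) (sym (from-start (toℕ y) y refl))
      where
      start : Fin n
      start = fromℕ< (ℕₚ.≤-<-trans z≤n (Finₚ.toℕ<n x))
      from-start : ∀ k z → toℕ z ≡ k → S z ≡ S start
      from-start zero    z z≡0 = cong S (Finₚ.toℕ-injective (trans z≡0 (sym (Finₚ.toℕ-fromℕ< _))))
      from-start (suc k) z z≡1+k = trans
        (sym (step-≡ z′ z (trans z≡1+k (cong suc (sym z′≡k)))
          (¬blk (toℕ z) (subst (0 <_) (sym z≡1+k) (s≤s z≤n)) (Finₚ.toℕ<n z))))
        (from-start k z′ z′≡k)
        where
        k<n : k < n
        k<n = ℕₚ.<-trans (ℕₚ.n<1+n k) (subst (_< n) z≡1+k (Finₚ.toℕ<n z))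
        z′ : Fin n
        z′ = fromℕ< k<n
        z′≡k : toℕ z′ ≡ k
        z′≡k = Finₚ.toℕ-fromℕ< k<n

  module _ {n} (v : Vec (Fin n) n) (i : Fin n) where

    private
      reach : ℕ → Subset.Subset n
      reach t = tabulate (walkWithin v t i)

      ∈⇒ : ∀ {t j} → j Subset.∈ reach t → T (walkWithin v t i j)
      ∈⇒ {t} {j} j∈ = true⇒T (trans (sym (Vecₚ.lookup∘tabulate (walkWithin v t i) j)) (Vecₚ.[]=⇒lookup j∈))

      ∈⇐ : ∀ {t j} → T (walkWithin v t i j) → j Subset.∈ reach t
      ∈⇐ {t} {j} w = Vecₚ.lookup⇒[]= j (reach t) (trans (Vecₚ.lookup∘tabulate (walkWithin v t i) j) (T⇒true w))

    walk-step : ∀ t {j k} → T (walkWithin v t i j) → Adj v j k → T (walkWithin v (suc t) i k)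
    walk-step t {j} w e = ∨⇐ (inj₂ (any⇐ j (∧⇐ w (adj⇐ v e))))

    -- The set of vertices within distance t grows until it is closed under adjacency,
    -- so n steps suffice.
    closed-or-large : ∀ t → Closed v (walkWithin v t i) ⊎ t < Subset.∣ reach t ∣
    closed-or-large zero = inj₂ (subst (_≤ Subset.∣ reach 0 ∣) (Subsetₚ.∣⁅x⁆∣≡1 i)
      (Subsetₚ.p⊆q⇒∣p∣≤∣q∣ λ x∈ → ∈⇐ {0} (≡⇒==ᶠ (sym (Subsetₚ.x∈⁅y⁆⇒x≡y i x∈)))))
    closed-or-large (suc t) with closed-or-large t
    ... | inj₁ closed = inj₁ λ e w → ∨⇐ (inj₁ (closed e (back w)))
      where
      back : ∀ {j} → T (walkWithin v (suc t) i j) → T (walkWithin v t i j)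
      back w with walk-suc⇒ v t w
      ... | inj₁ w′           = w′
      ... | inj₂ (x , w′ , e) = closed e w′
    ... | inj₂ t<r with Finₚ.any? (λ j → 𝔹ₚ.T? (walkWithin v (suc t) i j) ×-dec ¬? (𝔹ₚ.T? (walkWithin v t i j)))
    ...   | yes (j , new , ¬old) = inj₂ (ℕₚ.≤-<-trans t<r (Subsetₚ.p⊂q⇒∣p∣<∣q∣
              ((λ x∈ → ∈⇐ {suc t} (∨⇐ (inj₁ (∈⇒ {t} x∈)))) , j , ∈⇐ {suc t} new , λ x∈ → ¬old (∈⇒ {t} x∈))))
    ...   | no  none = inj₁ λ {j} {k} e w → ∨⇐ (inj₁ (old (walk-step t (old w) e)))
      where
      old : ∀ {j} → T (walkWithin v (suc t) i j) → T (walkWithin v t i j)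
      old {j} w = decidable-stable (𝔹ₚ.T? _) λ ¬w → none (j , w , ¬w)

    walk-closed : Closed v (walkWithin v n i)
    walk-closed with closed-or-large n
    ... | inj₁ closed = closed
    ... | inj₂ n<r    = ⊥-elim (ℕₚ.<⇒≱ n<r (Subsetₚ.∣p∣≤n (reach n)))

    walk-refl : ∀ t → T (walkWithin v t i i)
    walk-refl zero    = ≡⇒==ᶠ {i = i} refl
    walk-refl (suc t) = ∨⇐ (inj₁ (walk-refl t))

  -- The set reached from i within n steps is closed under adjacency, so its indicator is constant;
  -- as it contains i, it contains every j.
  ¬block⇒connected : ∀ {n} (v : Vec (Fin n) n) → Inj v →
    (∀ m → 0 < m → m < n → ¬ Block v m) → T (connected v)
  ¬block⇒connected {n} v inj ¬blk = all⇐ λ i → all⇐ λ j →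
    subst T (constant v inj (walk-closed v i) ¬blk i j) (walk-refl v i n)

  -- The recursion takes off the largest index, so that the part before index n is exactly what the
  -- minimality of n refers to.
  anyBelow : (ℕ → Bool) → ℕ → Bool
  anyBelow b zero    = false
  anyBelow b (suc n) = anyBelow b n ∨ b n

  anyBelow⇒ : ∀ {b} n → T (anyBelow b n) → ∃ λ i → i < n × T (b i)
  anyBelow⇒ (suc n) t with ∨⇒ t
  ... | inj₁ t′ = let i , i<n , bi = anyBelow⇒ n t′ in i , ℕₚ.m≤n⇒m≤1+n i<n , bi
  ... | inj₂ bn = n , ℕₚ.n<1+n n , bn

  anyBelow⇐ : ∀ {b} n {i} → i < n → T (b i) → T (anyBelow b n)
  anyBelow⇐ (suc n) {i} (s≤s i≤n) bi with ℕₚ.m≤n⇒m<n∨m≡n i≤n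
  ... | inj₁ i<n = ∨⇐ (inj₁ (anyBelow⇐ n i<n bi))
  ... | inj₂ refl = ∨⇐ {a = anyBelow _ n} (inj₂ bi)

  anyBelow-cong : ∀ {b b′} n → (∀ i → i < n → b i ≡ b′ i) → anyBelow b n ≡ anyBelow b′ n
  anyBelow-cong zero    b≡b′ = refl
  anyBelow-cong (suc n) b≡b′ = cong₂ _∨_ (anyBelow-cong n λ i i<n → b≡b′ i (ℕₚ.m≤n⇒m≤1+n i<n)) (b≡b′ n (ℕₚ.n<1+n n))

  does⇒ : ∀ {P : Set} (d : Dec P) → T (does d) → P
  does⇒ (yes p) _ = p

  does⇐ : ∀ {P : Set} (d : Dec P) → P → T (does d)
  does⇐ (yes _) _ = tt
  does⇐ (no ¬p) p = ⊥-elim (¬p p)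

  -- Shifting by `suc` leaves the sizes 1, ..., n, which are those of the nonempty proper initial
  -- segments of n + 1 vertices.
  not-connected : ∀ {n} (v : Vec (Fin (suc n)) (suc n)) → T (injective v) →
    not (connected v) ≡ anyBelow (block v ∘ suc) n
  not-connected {n} v inj with connected v in conn | anyBelow (block v ∘ suc) n in cut
  ... | true  | false = refl
  ... | false | true  = refl
  ... | true  | true  with i , i<n , b ← anyBelow⇒ n (true⇒T cut) =
    ⊥-elim (block⇒¬connected (s≤s z≤n) (s≤s i<n) (does⇒ (block? v (suc i)) b) (true⇒T conn))
  ... | false | false = ⊥-elim (subst T conn (¬block⇒connected v (λ {p} {q} → injective⇒Inj v inj {p} {q}) none))
    where
    none : ∀ m → 0 < m → m < suc n → ¬ Block v m
    none (suc m) _ (s≤s m<n) b = subst T cut (anyBelow⇐ n m<n (does⇐ (block? v (suc m)) b))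

  -- Direct sums of permutations

  infixr 6 _⊕_

  _⊕_ : ∀ {m p} → Vec (Fin m) m → Vec (Fin p) p → Vec (Fin (m + p)) (m + p)
  _⊕_ {m} {p} σ τ = Vec.map (_↑ˡ p) σ ++ Vec.map (m ↑ʳ_) τ

  module _ {m p} (σ : Vec (Fin m) m) (τ : Vec (Fin p) p) where

    ⊕-left : ∀ i → lookup (σ ⊕ τ) (i ↑ˡ p) ≡ lookup σ i ↑ˡ p
    ⊕-left i = trans (Vecₚ.lookup-++ˡ (Vec.map (_↑ˡ p) σ) _ i) (Vecₚ.lookup-map i _ σ)

    ⊕-right : ∀ i → lookup (σ ⊕ τ) (m ↑ʳ i) ≡ m ↑ʳ lookup τ i
    ⊕-right i = trans (Vecₚ.lookup-++ʳ (Vec.map (_↑ˡ p) σ) _ i) (Vecₚ.lookup-map i _ τ)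

    ⊕-Inj : Inj σ → Inj τ → Inj (σ ⊕ τ)
    ⊕-Inj injσ injτ {x} {y} eq with side m p x | side m p y
    ... | left i  | left j  = cong (_↑ˡ p) (injσ (Finₚ.↑ˡ-injective p _ _
                                (trans (sym (⊕-left i)) (trans eq (⊕-left j)))))
    ... | left i  | right j = ⊥-elim (left≢right (trans (sym (⊕-left i)) (trans eq (⊕-right j))))
    ... | right i | left j  = ⊥-elim (left≢right (trans (sym (⊕-left j)) (trans (sym eq) (⊕-right i))))
    ... | right i | right j = cong (m ↑ʳ_) (injτ (Finₚ.↑ʳ-injective m _ _
                                (trans (sym (⊕-right i)) (trans eq (⊕-right j)))))

    ⊕-Injˡ : Inj (σ ⊕ τ) → Inj σ
    ⊕-Injˡ inj {x} {y} eq = Finₚ.↑ˡ-injective p x y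
      (inj (trans (⊕-left x) (trans (cong (_↑ˡ p) eq) (sym (⊕-left y)))))

    ⊕-Injʳ : Inj (σ ⊕ τ) → Inj τ
    ⊕-Injʳ inj {x} {y} eq = Finₚ.↑ʳ-injective m x y
      (inj (trans (⊕-right x) (trans (cong (m ↑ʳ_) eq) (sym (⊕-right y)))))

    injective-⊕ : injective (σ ⊕ τ) ≡ injective σ ∧ injective τ
    injective-⊕ = bool-ext
      (λ t → let inj = injective⇒Inj (σ ⊕ τ) t in
             ∧⇐ (Inj⇒injective {v = σ} (λ {x} → ⊕-Injˡ (λ {p} → inj {p}) {x}))
                (Inj⇒injective {v = τ} (λ {x} → ⊕-Injʳ (λ {p} → inj {p}) {x})))
      (λ t → let tσ , tτ = ∧⇒ t in Inj⇒injective {v = σ ⊕ τ} (λ {x} →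
             ⊕-Inj (λ {p} → injective⇒Inj σ tσ {p}) (λ {p} → injective⇒Inj τ tτ {p}) {x}))

    Block-⊕ : Block (σ ⊕ τ) m
    Block-⊕ x with side m p x
    ... | left i  = trans (<ᵇ-↑ˡ i p) (sym (trans (cong (λ y → toℕ y <ᵇ m) (⊕-left i)) (<ᵇ-↑ˡ (lookup σ i) p)))
    ... | right i = trans (<ᵇ-↑ʳ m i) (sym (trans (cong (λ y → toℕ y <ᵇ m) (⊕-right i)) (<ᵇ-↑ʳ m (lookup τ i))))

    Block-⊕-≤⇒ : ∀ k → Block (σ ⊕ τ) k → Block σ k
    Block-⊕-≤⇒ k blk i = trans (cong (_<ᵇ k) (sym (Finₚ.toℕ-↑ˡ i p)))
      (trans (blk (i ↑ˡ p)) (cong (_<ᵇ k) (trans (cong toℕ (⊕-left i)) (Finₚ.toℕ-↑ˡ _ p))))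

    Block-⊕-≤⇐ : ∀ k → k ≤ m → Block σ k → Block (σ ⊕ τ) k
    Block-⊕-≤⇐ k k≤m blk x with side m p x
    ... | left i  = trans (cong (_<ᵇ k) (Finₚ.toℕ-↑ˡ i p))
      (trans (blk i) (cong (_<ᵇ k) (sym (trans (cong toℕ (⊕-left i)) (Finₚ.toℕ-↑ˡ _ p)))))
    ... | right i = trans (far i) (sym (trans (cong (λ y → toℕ y <ᵇ k) (⊕-right i)) (far _)))
      where
      far : ∀ j → (toℕ (m ↑ʳ j) <ᵇ k) ≡ false
      far j = <ᵇ-false (ℕₚ.≤-trans k≤m (subst (m ≤_) (sym (Finₚ.toℕ-↑ʳ m j)) (ℕₚ.m≤m+n m (toℕ j))))

    -- The values and positions of `τ` all lie beyond a cut at k ≤ m, so only `σ` is tested. Hence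
    -- whether m is the first block of the sum depends on `σ` alone.
    block-⊕ : ∀ {k} → k ≤ m → block (σ ⊕ τ) k ≡ block σ k
    block-⊕ {k} k≤m = bool-ext
      (λ t → does⇐ (block? σ k) (Block-⊕-≤⇒ k (does⇒ (block? (σ ⊕ τ) k) t)))
      (λ t → does⇐ (block? (σ ⊕ τ) k) (Block-⊕-≤⇐ k k≤m (does⇒ (block? σ k) t)))

    private
      ↑ˡ-mono : ∀ {i j : Fin m} → i Fin.< j → (i ↑ˡ p) Fin.< (j ↑ˡ p)
      ↑ˡ-mono {i} {j} = subst₂ _<_ (sym (Finₚ.toℕ-↑ˡ i p)) (sym (Finₚ.toℕ-↑ˡ j p))
      ↑ˡ-cancel : ∀ {i j : Fin m} → (i ↑ˡ p) Fin.< (j ↑ˡ p) → i Fin.< j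
      ↑ˡ-cancel {i} {j} = subst₂ _<_ (Finₚ.toℕ-↑ˡ i p) (Finₚ.toℕ-↑ˡ j p)
      ↑ʳ-mono : ∀ {i j : Fin p} → i Fin.< j → (m ↑ʳ i) Fin.< (m ↑ʳ j)
      ↑ʳ-mono {i} {j} i<j = subst₂ _<_ (sym (Finₚ.toℕ-↑ʳ m i)) (sym (Finₚ.toℕ-↑ʳ m j)) (ℕₚ.+-monoʳ-< m i<j)
      ↑ʳ-cancel : ∀ {i j : Fin p} → (m ↑ʳ i) Fin.< (m ↑ʳ j) → i Fin.< j
      ↑ʳ-cancel {i} {j} lt = ℕₚ.+-cancelˡ-< m _ _ (subst₂ _<_ (Finₚ.toℕ-↑ʳ m i) (Finₚ.toℕ-↑ʳ m j) lt)

      position-left : ∀ {x i} → lookup (σ ⊕ τ) x ≡ i ↑ˡ p → ∃ λ y → x ≡ y ↑ˡ p × lookup σ y ≡ i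
      position-left {x} eq with side m p x
      ... | left y  = y , refl , Finₚ.↑ˡ-injective p _ _ (trans (sym (⊕-left y)) eq)
      ... | right y = ⊥-elim (left≢right (trans (sym eq) (⊕-right y)))

      position-right : ∀ {x i} → lookup (σ ⊕ τ) x ≡ m ↑ʳ i → ∃ λ y → x ≡ m ↑ʳ y × lookup τ y ≡ i
      position-right {x} eq with side m p x
      ... | left y  = ⊥-elim (left≢right (trans (sym (⊕-left y)) eq))
      ... | right y = y , refl , Finₚ.↑ʳ-injective m _ _ (trans (sym (⊕-right y)) eq)

      edge-left⇒ : ∀ {i j} → EdgeOrd (σ ⊕ τ) (i ↑ˡ p) (j ↑ˡ p) → EdgeOrd σ i j
      edge-left⇒ (i<j , x , y , vx , vy , y<x)
        with x′ , refl , ex ← position-left {x} vx | y′ , refl , ey ← position-left {y} vy =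
        ↑ˡ-cancel i<j , x′ , y′ , ex , ey , ↑ˡ-cancel y<x

      edge-right⇒ : ∀ {i j} → EdgeOrd (σ ⊕ τ) (m ↑ʳ i) (m ↑ʳ j) → EdgeOrd τ i j
      edge-right⇒ (i<j , x , y , vx , vy , y<x)
        with x′ , refl , ex ← position-right {x} vx | y′ , refl , ey ← position-right {y} vy =
        ↑ʳ-cancel i<j , x′ , y′ , ex , ey , ↑ʳ-cancel y<x

      edge-left⇐ : ∀ {i j} → EdgeOrd σ i j → EdgeOrd (σ ⊕ τ) (i ↑ˡ p) (j ↑ˡ p)
      edge-left⇐ (i<j , x , y , ex , ey , y<x) = ↑ˡ-mono i<j , x ↑ˡ p , y ↑ˡ p ,
        trans (⊕-left x) (cong (_↑ˡ p) ex) , trans (⊕-left y) (cong (_↑ˡ p) ey) , ↑ˡ-mono y<x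

      edge-right⇐ : ∀ {i j} → EdgeOrd τ i j → EdgeOrd (σ ⊕ τ) (m ↑ʳ i) (m ↑ʳ j)
      edge-right⇐ (i<j , x , y , ex , ey , y<x) = ↑ʳ-mono i<j , m ↑ʳ x , m ↑ʳ y ,
        trans (⊕-right x) (cong (m ↑ʳ_) ex) , trans (⊕-right y) (cong (m ↑ʳ_) ey) , ↑ʳ-mono y<x

    adj-left⇒ : ∀ {i j} → Adj (σ ⊕ τ) (i ↑ˡ p) (j ↑ˡ p) → Adj σ i j
    adj-left⇒ = Sum.map edge-left⇒ edge-left⇒
    adj-left⇐ : ∀ {i j} → Adj σ i j → Adj (σ ⊕ τ) (i ↑ˡ p) (j ↑ˡ p)
    adj-left⇐ = Sum.map edge-left⇐ edge-left⇐
    adj-right⇒ : ∀ {i j} → Adj (σ ⊕ τ) (m ↑ʳ i) (m ↑ʳ j) → Adj τ i j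
    adj-right⇒ = Sum.map edge-right⇒ edge-right⇒
    adj-right⇐ : ∀ {i j} → Adj τ i j → Adj (σ ⊕ τ) (m ↑ʳ i) (m ↑ʳ j)
    adj-right⇐ = Sum.map edge-right⇐ edge-right⇐

    ¬adj-left-right : ∀ {i j} → ¬ Adj (σ ⊕ τ) (i ↑ˡ p) (m ↑ʳ j)
    ¬adj-left-right {i} {j} e = contradiction
      (trans (sym (<ᵇ-↑ˡ i p)) (trans (adj-side {v = σ ⊕ τ} {m} Block-⊕ e) (<ᵇ-↑ʳ m j))) λ ()

    ¬adj-right-left : ∀ {i j} → ¬ Adj (σ ⊕ τ) (m ↑ʳ j) (i ↑ˡ p)
    ¬adj-right-left e = ¬adj-left-right (Sum.swap e)

  -- Additivity and positivity of the domination number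

  Dominating : ∀ {n} → Vec (Fin n) n → Vec Bool n → Set
  Dominating v D = ∀ x → T (lookup D x) ⊎ ∃ λ u → T (lookup D u) × Adj v u x

  dominating⇒ : ∀ {n} (v : Vec (Fin n) n) D → T (dominating v D) → Dominating v D
  dominating⇒ {n} v D t x with ∨⇒ {lookup D x} (all⇒ t x)
  ... | inj₁ x∈ = inj₁ x∈
  ... | inj₂ s with u , s′ ← any⇒ {p = λ u → lookup D u ∧ adj v u x} s
               with u∈ , e ← ∧⇒ {lookup D u} s′ = inj₂ (u , u∈ , adj⇒ v e)

  dominating⇐ : ∀ {n} (v : Vec (Fin n) n) D → Dominating v D → T (dominating v D)
  dominating⇐ {n} v D dom = all⇐ λ x → ∨⇐ {lookup D x} (case x)
    where
    case : ∀ x → T (lookup D x) ⊎ _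
    case x with dom x
    ... | inj₁ x∈ = inj₁ x∈
    ... | inj₂ (u , u∈ , e) = inj₂ (any⇐ {p = λ u → lookup D u ∧ adj v u x} u (∧⇐ u∈ (adj⇐ v e)))

  module _ {m p} (σ : Vec (Fin m) m) (τ : Vec (Fin p) p) (D : Vec Bool m) (E : Vec Bool p) where

    private
      ∈-left : ∀ i → lookup (D ++ E) (i ↑ˡ p) ≡ lookup D i
      ∈-left = Vecₚ.lookup-++ˡ D E
      ∈-right : ∀ i → lookup (D ++ E) (m ↑ʳ i) ≡ lookup E i
      ∈-right = Vecₚ.lookup-++ʳ D E

    Dominating-⊕⇐ : Dominating σ D → Dominating τ E → Dominating (σ ⊕ τ) (D ++ E)
    Dominating-⊕⇐ domσ domτ x with side m p x
    ... | left i with domσ i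
    ...   | inj₁ i∈ = inj₁ (subst T (sym (∈-left i)) i∈)
    ...   | inj₂ (u , u∈ , e) = inj₂ (u ↑ˡ p , subst T (sym (∈-left u)) u∈ , adj-left⇐ σ τ e)
    Dominating-⊕⇐ domσ domτ x | right i with domτ i
    ...   | inj₁ i∈ = inj₁ (subst T (sym (∈-right i)) i∈)
    ...   | inj₂ (u , u∈ , e) = inj₂ (m ↑ʳ u , subst T (sym (∈-right u)) u∈ , adj-right⇐ σ τ e)

    -- No edge joins the two summands, so whatever dominates a left vertex is itself on the left.
    Dominating-⊕⇒ˡ : Dominating (σ ⊕ τ) (D ++ E) → Dominating σ D
    Dominating-⊕⇒ˡ dom i with dom (i ↑ˡ p)
    ... | inj₁ i∈ = inj₁ (subst T (∈-left i) i∈)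
    ... | inj₂ (u , u∈ , e) with side m p u
    ...   | left j  = inj₂ (j , subst T (∈-left j) u∈ , adj-left⇒ σ τ e)
    ...   | right j = ⊥-elim (¬adj-right-left σ τ e)

    Dominating-⊕⇒ʳ : Dominating (σ ⊕ τ) (D ++ E) → Dominating τ E
    Dominating-⊕⇒ʳ dom i with dom (m ↑ʳ i)
    ... | inj₁ i∈ = inj₁ (subst T (∈-right i) i∈)
    ... | inj₂ (u , u∈ , e) with side m p u
    ...   | left j  = ⊥-elim (¬adj-left-right σ τ e)
    ...   | right j = inj₂ (j , subst T (∈-right j) u∈ , adj-right⇒ σ τ e)

  ∈-vecsOver : ∀ {A : Set} {xs : List A} → (∀ x → x ∈ xs) → ∀ {m} (v : Vec A m) → v ∈ vecsOver m xs
  ∈-vecsOver all∈ []      = here refl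
  ∈-vecsOver {xs = xs} all∈ {suc m} (x ∷ v) = ∈-concatMap⁺ (λ x → map (x ∷_) (vecsOver m xs))
    (lose (all∈ x) (∈-map⁺ (x ∷_) (∈-vecsOver all∈ v)))

  ∈-subsets : ∀ {n} (D : Vec Bool n) → D ∈ subsets n
  ∈-subsets = ∈-vecsOver λ { true → here refl ; false → there (here refl) }

  module _ {A : Set} (p : A → Bool) (s : A → ℕ) (n : ℕ) where

    private
      min : List A → ℕ
      min = foldr (λ D acc → if p D then s D ⊓ acc else acc) n

    min-≤ : ∀ {xs D} → D ∈ xs → T (p D) → min xs ≤ s D
    min-≤ {x ∷ xs} (here refl) pD with p x
    ... | true = ℕₚ.m⊓n≤m _ _
    min-≤ {x ∷ xs} (there D∈) pD with p x
    ... | true  = ℕₚ.≤-trans (ℕₚ.m⊓n≤n (s x) _) (min-≤ D∈ pD)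
    ... | false = min-≤ D∈ pD

    -- The initial value n may survive the fold. For domination numbers that case is still attained,
    -- by the full vertex set of size n.
    min-attained : ∀ xs → min xs ≡ n ⊎ ∃ λ D → T (p D) × min xs ≡ s D
    min-attained [] = inj₁ refl
    min-attained (x ∷ xs) with p x in eq
    ... | false = min-attained xs
    ... | true with ℕₚ.⊓-sel (s x) (min xs)
    ...   | inj₁ is-s = inj₂ (x , true⇒T eq , is-s)
    ...   | inj₂ is-m with min-attained xs
    ...     | inj₁ is-n = inj₁ (trans is-m is-n)
    ...     | inj₂ (D , pD , is-D) = inj₂ (D , pD , trans is-m is-D)

  size-full : ∀ n → size (replicate n true) ≡ n
  size-full zero    = refl
  size-full (suc n) = cong suc (size-full n)

  size-++ : ∀ {m p} (D : Vec Bool m) (E : Vec Bool p) → size (D ++ E) ≡ size D + size E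
  size-++ []          E = refl
  size-++ (true ∷ D)  E = cong suc (size-++ D E)
  size-++ (false ∷ D) E = size-++ D E

  dominationNumber-≤ : ∀ {n} (v : Vec (Fin n) n) D → Dominating v D → dominationNumber v ≤ size D
  dominationNumber-≤ {n} v D dom = min-≤ (dominating v) size n (∈-subsets D) (dominating⇐ v D dom)

  dominationNumber-attained : ∀ {n} (v : Vec (Fin n) n) →
    ∃ λ D → Dominating v D × dominationNumber v ≡ size D
  dominationNumber-attained {n} v with min-attained (dominating v) size n (subsets n)
  ... | inj₁ is-n = replicate n true , (λ x → inj₁ (true⇒T (Vecₚ.lookup-replicate x true))) ,
                    trans is-n (sym (size-full n))
  ... | inj₂ (D , dom , is-D) = D , dominating⇒ v D dom , is-D

  -- Minimum dominating sets of the summands concatenate to a dominating set of the sum; conversely,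
  -- a minimum one of the sum splits at m into dominating sets of both summands.
  dominationNumber-⊕ : ∀ {m p} (σ : Vec (Fin m) m) (τ : Vec (Fin p) p) →
    dominationNumber (σ ⊕ τ) ≡ dominationNumber σ + dominationNumber τ
  dominationNumber-⊕ {m} {p} σ τ = ℕₚ.≤-antisym upper lower
    where
    upper : dominationNumber (σ ⊕ τ) ≤ dominationNumber σ + dominationNumber τ
    upper with D , domD , eqD ← dominationNumber-attained σ | E , domE , eqE ← dominationNumber-attained τ =
      subst (dominationNumber (σ ⊕ τ) ≤_) (trans (size-++ D E) (sym (cong₂ _+_ eqD eqE)))
        (dominationNumber-≤ (σ ⊕ τ) (D ++ E) (Dominating-⊕⇐ σ τ D E domD domE))
    lower : dominationNumber σ + dominationNumber τ ≤ dominationNumber (σ ⊕ τ)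
    lower with F , domF , eqF ← dominationNumber-attained (σ ⊕ τ)
          with D , E , refl ← Vec.splitAt m F =
      subst (dominationNumber σ + dominationNumber τ ≤_) (sym (trans eqF (size-++ D E)))
        (ℕₚ.+-mono-≤ (dominationNumber-≤ σ D (Dominating-⊕⇒ˡ σ τ D E domF))
                     (dominationNumber-≤ τ E (Dominating-⊕⇒ʳ σ τ D E domF)))

  -- A set of size 0 has no member and leaves vertex `zero` undominated. This is the source of
  -- `c (suc n) 0 ≡ 0`, on which all divisibility by y rests.
  dominationNumber-positive : ∀ {n} (v : Vec (Fin (suc n)) (suc n)) → dominationNumber v ≢ 0
  dominationNumber-positive v eq with D , dom , eqD ← dominationNumber-attained v = empty (dom zero)
    where
    size-zero : ∀ {n} (D : Vec Bool n) → size D ≡ 0 → ∀ x → ¬ T (lookup D x)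
    size-zero (true ∷ D)  ()
    size-zero (false ∷ D) eq zero    ()
    size-zero (false ∷ D) eq (suc x) x∈ = size-zero D eq x x∈
    empty : ¬ (T (lookup D zero) ⊎ ∃ λ u → T (lookup D u) × Adj v u zero)
    empty (inj₁ x∈) = size-zero D (trans (sym eqD) eq) zero x∈
    empty (inj₂ (u , u∈ , _)) = size-zero D (trans (sym eqD) eq) u u∈

module GeneratingFunctions where
  open PermutationGraphs using (<ᵇ-false)
  open import Algebra.Bundles using (CommutativeSemiring)
  open import Algebra.Structures using (IsCommutativeSemiring)
  open import Data.Bool using (Bool; true; false; _∧_; if_then_else_; T)
  open import Data.Fin using (toℕ)
  open import Data.List using (List; []; _∷_; _++_; map; concatMap; filterᵇ; upTo; foldr; applyUpTo)
  open import Data.List.Relation.Unary.All using (All; []; _∷_)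
  open import Data.Nat as ℕ using (zero; suc; _<_; _∸_; _≤ᵇ_; _<ᵇ_; _≡ᵇ_; z≤n; s≤s)
  open import Data.Nat.Combinatorics using (_C_)
  import Data.Nat.Properties as ℕₚ
  open import Data.Product using (_,_)
  open import Data.Vec using (Vec; []; _∷_)
  import Data.Vec.Relation.Unary.All as VAll
  open import Function using (_∘_)
  open import Level using (0ℓ)
  import Relation.Binary.PropositionalEquality as ≡

  -- Passes a condition on the sum of a vector from `s ∷ v` to its tail; the guard makes up for the
  -- truncation in `r ∸ s`.
  +≡ᵇ : ∀ s v r → (s ℕ.+ v ≡ᵇ r) ≡ (s ≤ᵇ r) ∧ (v ≡ᵇ r ∸ s)
  +≡ᵇ zero          v r       = ≡.refl
  +≡ᵇ (suc s)       v zero    = ≡.refl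
  +≡ᵇ (suc zero)    v (suc r) = ≡.refl
  +≡ᵇ (suc (suc s)) v (suc r) = +≡ᵇ (suc s) v r

  -- Finite sums and indicators in an arbitrary commutative semiring

  module Sums (R : CommutativeSemiring 0ℓ 0ℓ) where
    open CommutativeSemiring R
    open import Relation.Binary.Reasoning.Setoid setoid
    open import Algebra.Properties.CommutativeSemigroup +-commutativeSemigroup
      using (interchange)

    ∑ : {A : Set} → List A → (A → Carrier) → Carrier
    ∑ xs f = foldr _+_ 0# (map f xs)

    -- The Iverson bracket: as multipliers, filters and case distinctions commute with sums and
    -- products.
    when : Bool → Carrier → Carrier
    when b x = if b then x else 0#

    ∑< : ℕ → (ℕ → Carrier) → Carrier
    ∑< n = ∑ (upTo n)

    when-cong : ∀ b {x y} → x ≈ y → when b x ≈ when b y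
    when-cong true  x≈y = x≈y
    when-cong false _   = refl

    when-cong-T : ∀ b {x y} → (T b → x ≈ y) → when b x ≈ when b y
    when-cong-T true  x≈y = x≈y _
    when-cong-T false _   = refl

    when-false : ∀ {b x} → b ≡ false → when b x ≈ 0#
    when-false ≡.refl = refl

    when-zero : ∀ b → when b 0# ≈ 0#
    when-zero true  = refl
    when-zero false = refl

    when-+ : ∀ b x y → when b (x + y) ≈ when b x + when b y
    when-+ true  x y = refl
    when-+ false x y = sym (+-identityˡ 0#)

    when-∧ : ∀ b b′ x → when (b ∧ b′) x ≈ when b (when b′ x)
    when-∧ true  b′ x = refl
    when-∧ false b′ x = refl

    when-comm : ∀ b b′ x → when b (when b′ x) ≈ when b′ (when b x)
    when-comm true  b′ x = refl
    when-comm false b′ x = sym (when-zero b′)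

    when-*ˡ : ∀ b a x → a * when b x ≈ when b (a * x)
    when-*ˡ true  a x = refl
    when-*ˡ false a x = zeroʳ a

    when-*ʳ : ∀ b a x → when b x * a ≈ when b (x * a)
    when-*ʳ true  a x = refl
    when-*ʳ false a x = zeroˡ a

    module _ {A : Set} where

      ∑-cong : ∀ (xs : List A) {f g : A → Carrier} → (∀ x → f x ≈ g x) → ∑ xs f ≈ ∑ xs g
      ∑-cong []       f≈g = refl
      ∑-cong (x ∷ xs) f≈g = +-cong (f≈g x) (∑-cong xs f≈g)

      ∑-congᴬ : ∀ {P : A → Set} {xs} → All P xs → {f g : A → Carrier} →
                (∀ x → P x → f x ≈ g x) → ∑ xs f ≈ ∑ xs g
      ∑-congᴬ []         f≈g = refl
      ∑-congᴬ (px ∷ pxs) f≈g = +-cong (f≈g _ px) (∑-congᴬ pxs f≈g)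

      ∑-zero : ∀ (xs : List A) {f : A → Carrier} → (∀ x → f x ≈ 0#) → ∑ xs f ≈ 0#
      ∑-zero []       f≈0 = refl
      ∑-zero (x ∷ xs) f≈0 = trans (+-cong (f≈0 x) (∑-zero xs f≈0)) (+-identityˡ 0#)

      ∑-+ : ∀ (xs : List A) (f g : A → Carrier) → ∑ xs (λ x → f x + g x) ≈ ∑ xs f + ∑ xs g
      ∑-+ []       f g = sym (+-identityˡ 0#)
      ∑-+ (x ∷ xs) f g = trans (+-congˡ (∑-+ xs f g)) (interchange _ _ _ _)

      ∑-*ˡ : ∀ (xs : List A) a (f : A → Carrier) → a * ∑ xs f ≈ ∑ xs (λ x → a * f x)
      ∑-*ˡ []       a f = zeroʳ a
      ∑-*ˡ (x ∷ xs) a f = trans (distribˡ a _ _) (+-congˡ (∑-*ˡ xs a f))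

      ∑-*ʳ : ∀ (xs : List A) a (f : A → Carrier) → ∑ xs f * a ≈ ∑ xs (λ x → f x * a)
      ∑-*ʳ []       a f = zeroˡ a
      ∑-*ʳ (x ∷ xs) a f = trans (distribʳ a _ _) (+-congˡ (∑-*ʳ xs a f))

      ∑-when : ∀ (xs : List A) b (f : A → Carrier) → when b (∑ xs f) ≈ ∑ xs (λ x → when b (f x))
      ∑-when xs true  f = refl
      ∑-when xs false f = sym (∑-zero xs (λ _ → refl))

      ∑-++ : ∀ (xs ys : List A) (f : A → Carrier) → ∑ (xs ++ ys) f ≈ ∑ xs f + ∑ ys f
      ∑-++ []       ys f = sym (+-identityˡ _)
      ∑-++ (x ∷ xs) ys f = trans (+-congˡ (∑-++ xs ys f)) (sym (+-assoc _ _ _))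

      ∑-filter : ∀ (xs : List A) p (f : A → Carrier) →
                 ∑ (filterᵇ p xs) f ≈ ∑ xs (λ x → when (p x) (f x))
      ∑-filter []       p f = refl
      ∑-filter (x ∷ xs) p f with p x
      ... | true  = +-congˡ (∑-filter xs p f)
      ... | false = trans (∑-filter xs p f) (sym (+-identityˡ _))

    ∑-map : ∀ {A B : Set} (h : A → B) xs (f : B → Carrier) → ∑ (map h xs) f ≈ ∑ xs (f ∘ h)
    ∑-map h []       f = refl
    ∑-map h (x ∷ xs) f = +-congˡ (∑-map h xs f)

    ∑-concatMap : ∀ {A B : Set} (h : A → List B) xs (f : B → Carrier) →
                  ∑ (concatMap h xs) f ≈ ∑ xs (λ x → ∑ (h x) f)
    ∑-concatMap h []       f = refl
    ∑-concatMap h (x ∷ xs) f = trans (∑-++ (h x) _ f) (+-congˡ (∑-concatMap h xs f))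

    ∑-swap : ∀ {A B : Set} (xs : List A) (ys : List B) (f : A → B → Carrier) →
             ∑ xs (λ x → ∑ ys (f x)) ≈ ∑ ys (λ y → ∑ xs (λ x → f x y))
    ∑-swap []       ys f = sym (∑-zero ys (λ _ → refl))
    ∑-swap (x ∷ xs) ys f = trans (+-congˡ (∑-swap xs ys f)) (sym (∑-+ ys _ _))

    ∑-vecs : ∀ {A : Set} m (xs : List A) (f : Vec A (suc m) → Carrier) →
             ∑ (vecsOver (suc m) xs) f ≈ ∑ xs (λ x → ∑ (vecsOver m xs) (λ v → f (x ∷ v)))
    ∑-vecs m xs f = trans (∑-concatMap _ xs f) (∑-cong xs λ x → ∑-map (x ∷_) (vecsOver m xs) f)

    ∑-vecs-congᴬ : ∀ {A : Set} {P : A → Set} m {xs} → All P xs → {f g : Vec A m → Carrier} →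
                   (∀ v → VAll.All P v → f v ≈ g v) →
                   ∑ (vecsOver m xs) f ≈ ∑ (vecsOver m xs) g
    ∑-vecs-congᴬ zero    pxs f≈g = +-congʳ (f≈g [] VAll.[])
    ∑-vecs-congᴬ (suc m) {xs} pxs {f} {g} f≈g = begin
      ∑ (vecsOver (suc m) xs) f                         ≈⟨ ∑-vecs m xs f ⟩
      ∑ xs (λ x → ∑ (vecsOver m xs) (λ v → f (x ∷ v)))  ≈⟨ ∑-congᴬ pxs (λ x px →
        ∑-vecs-congᴬ m pxs (λ v pv → f≈g (x ∷ v) (px VAll.∷ pv))) ⟩
      ∑ xs (λ x → ∑ (vecsOver m xs) (λ v → g (x ∷ v)))  ≈⟨ ∑-vecs m xs g ⟨
      ∑ (vecsOver (suc m) xs) g                         ∎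

    ∑-applyUpTo : ∀ h n (f : ℕ → Carrier) → ∑ (applyUpTo h n) f ≈ ∑< n (f ∘ h)
    ∑-applyUpTo h zero    f = refl
    ∑-applyUpTo h (suc n) f = +-congˡ (trans (∑-applyUpTo (h ∘ suc) n f)
      (sym (∑-applyUpTo suc n (f ∘ h))))

    ∑<-suc : ∀ n f → ∑< (suc n) f ≈ f 0 + ∑< n (f ∘ suc)
    ∑<-suc n f = +-congˡ (∑-applyUpTo suc n f)

    ∑<-last : ∀ n f → ∑< (suc n) f ≈ ∑< n f + f n
    ∑<-last zero    f = +-comm _ _
    ∑<-last (suc n) f = begin
      ∑< (suc (suc n)) f                    ≈⟨ ∑<-suc (suc n) f ⟩
      f 0 + ∑< (suc n) (f ∘ suc)            ≈⟨ +-congˡ (∑<-last n (f ∘ suc)) ⟩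
      f 0 + (∑< n (f ∘ suc) + f (suc n))    ≈⟨ +-assoc _ _ _ ⟨
      f 0 + ∑< n (f ∘ suc) + f (suc n)      ≈⟨ +-congʳ (∑<-suc n f) ⟨
      ∑< (suc n) f + f (suc n)              ∎

    ∑<-cong : ∀ n {f g} → (∀ i → i < n → f i ≈ g i) → ∑< n f ≈ ∑< n g
    ∑<-cong zero    f≈g = refl
    ∑<-cong (suc n) {f} {g} f≈g = trans (∑<-suc n f) (trans
      (+-cong (f≈g 0 (s≤s z≤n)) (∑<-cong n (λ i i<n → f≈g (suc i) (s≤s i<n))))
      (sym (∑<-suc n g)))

    ∑-interval : ∀ a b f → ∑ (interval a b) f ≈ ∑< (suc b ∸ a) (λ i → f (a ℕ.+ i))
    ∑-interval a b f = ∑-map (a ℕ.+_) (upTo (suc b ∸ a)) f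

    ∑<-restrict : ∀ {r n} f → r ≤ n → ∑< n (λ i → when (i <ᵇ r) (f i)) ≈ ∑< r f
    ∑<-restrict {zero}  {n}     f _         = ∑-zero (upTo n) (λ _ → refl)
    ∑<-restrict {suc r} {suc n} f (s≤s r≤n) = begin
      ∑< (suc n) (λ i → when (i <ᵇ suc r) (f i))     ≈⟨ ∑<-suc n _ ⟩
      f 0 + ∑< n (λ i → when (i <ᵇ r) (f (suc i)))   ≈⟨ +-congˡ (∑<-restrict (f ∘ suc) r≤n) ⟩
      f 0 + ∑< r (f ∘ suc)                           ≈⟨ ∑<-suc r f ⟨
      ∑< (suc r) f                                   ∎

    ∑<-δ : ∀ n b (f : ℕ → Carrier) → b < n → ∑< n (λ i → when (i ≡ᵇ b) (f i)) ≈ f b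
    ∑<-δ (suc n) zero f _ = trans (∑<-suc n _)
      (trans (+-congˡ (∑-zero (upTo n) (λ _ → refl))) (+-identityʳ _))
    ∑<-δ (suc n) (suc b) f (s≤s b<n) = trans (∑<-suc n _)
      (trans (+-identityˡ _) (∑<-δ n b (f ∘ suc) b<n))

    ∑<-tail : ∀ n b (f : ℕ → Carrier) → b < n → ∑< n (λ i → when (b <ᵇ suc i) (f i)) ≈
              f b + ∑< n (λ i → when (suc b <ᵇ suc i) (f i))
    ∑<-tail (suc n) zero f _ = begin
      ∑< (suc n) f                  ≈⟨ ∑<-suc n f ⟩
      f 0 + ∑< n (f ∘ suc)          ≈⟨ +-congˡ (+-identityˡ _) ⟨
      f 0 + (0# + ∑< n (f ∘ suc))   ≈⟨ +-congˡ (∑<-suc n _) ⟨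
      _                             ∎
    ∑<-tail (suc n) (suc b) f (s≤s b<n) = begin
      ∑< (suc n) (λ i → when (suc b <ᵇ suc i) (f i))                      ≈⟨ ∑<-suc n _ ⟩
      0# + ∑< n (λ i → when (b <ᵇ suc i) (f (suc i)))                     ≈⟨ +-identityˡ _ ⟩
      ∑< n (λ i → when (b <ᵇ suc i) (f (suc i)))                          ≈⟨ ∑<-tail n b (f ∘ suc) b<n ⟩
      f (suc b) + ∑< n (λ i → when (suc b <ᵇ suc i) (f (suc i)))          ≈⟨ +-congˡ (+-identityˡ _) ⟨
      f (suc b) + (0# + ∑< n (λ i → when (suc b <ᵇ suc i) (f (suc i))))   ≈⟨ +-congˡ (∑<-suc n _) ⟨
      _                                                                   ∎

  -- Formal power series

  module PowerSeries (R : CommutativeSemiring 0ℓ 0ℓ) where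
    open CommutativeSemiring R
    open Sums R
    open import Relation.Binary.Reasoning.Setoid setoid
    open import Algebra.Properties.CommutativeSemigroup +-commutativeSemigroup
      using (interchange; x∙yz≈y∙xz)

    Series : Set
    Series = ℕ → Carrier

    infix 4 _≋_
    infixl 6 _⊞_
    infixl 7 _⊛_

    _≋_ : Series → Series → Set
    f ≋ g = ∀ n → f n ≈ g n

    _⊞_ : Series → Series → Series
    (f ⊞ g) n = f n + g n

    𝟎 𝟏 : Series
    𝟎 _ = 0#
    𝟏 zero    = 1#
    𝟏 (suc _) = 0#

    -- The Cauchy product, read off from f = f 0 + x (f ∘ suc). In this form the semiring laws are
    -- inductions on the coefficient index; `⊛-∑` recovers the usual sum.
    _⊛_ : Series → Series → Series
    (f ⊛ g) zero    = f 0 * g 0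
    (f ⊛ g) (suc n) = f 0 * g (suc n) + (f ∘ suc ⊛ g) n

    -- Coefficient n of a product involves only coefficients up to n. This locality later allows `C`
    -- to be replaced by a polynomial.
    ⊛-cong-≤ : ∀ n {f f′ g g′} → (∀ i → i ≤ n → f i ≈ f′ i) → (∀ i → i ≤ n → g i ≈ g′ i) →
               (f ⊛ g) n ≈ (f′ ⊛ g′) n
    ⊛-cong-≤ zero    p q = *-cong (p 0 z≤n) (q 0 z≤n)
    ⊛-cong-≤ (suc n) p q = +-cong (*-cong (p 0 z≤n) (q (suc n) ℕₚ.≤-refl))
      (⊛-cong-≤ n (λ i i≤n → p (suc i) (s≤s i≤n)) (λ i i≤n → q i (ℕₚ.m≤n⇒m≤1+n i≤n)))

    ⊛-∑ : ∀ n f g → (f ⊛ g) n ≈ ∑< (suc n) (λ i → f i * g (n ∸ i))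
    ⊛-∑ zero    f g = sym (+-identityʳ _)
    ⊛-∑ (suc n) f g = trans (+-congˡ (⊛-∑ n (f ∘ suc) g)) (sym (∑<-suc (suc n) _))

    ⊛-cong : ∀ {f f′ g g′} → f ≋ f′ → g ≋ g′ → f ⊛ g ≋ f′ ⊛ g′
    ⊛-cong p q n = ⊛-cong-≤ n (λ i _ → p i) (λ i _ → q i)

    ⊛-distribʳ : ∀ h f g → (f ⊞ g) ⊛ h ≋ (f ⊛ h) ⊞ (g ⊛ h)
    ⊛-distribʳ h f g zero    = distribʳ _ _ _
    ⊛-distribʳ h f g (suc n) = trans
      (+-cong (distribʳ _ _ _) (⊛-distribʳ h (f ∘ suc) (g ∘ suc) n)) (interchange _ _ _ _)

    ⊛-zeroˡ : ∀ f → 𝟎 ⊛ f ≋ 𝟎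
    ⊛-zeroˡ f zero    = zeroˡ _
    ⊛-zeroˡ f (suc n) = trans (+-cong (zeroˡ _) (⊛-zeroˡ f n)) (+-identityˡ 0#)

    ⊛-identityˡ : ∀ f → 𝟏 ⊛ f ≋ f
    ⊛-identityˡ f zero    = *-identityˡ _
    ⊛-identityˡ f (suc n) = trans (+-cong (*-identityˡ _) (⊛-zeroˡ f n)) (+-identityʳ _)

    ⊛-scaleˡ : ∀ a f g → (λ i → a * f i) ⊛ g ≋ (λ n → a * (f ⊛ g) n)
    ⊛-scaleˡ a f g zero    = *-assoc _ _ _
    ⊛-scaleˡ a f g (suc n) = trans
      (+-cong (*-assoc _ _ _) (⊛-scaleˡ a (f ∘ suc) g n)) (sym (distribˡ _ _ _))

    -- The mirror image of the defining recursion, shifting the right factor; commutativity follows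
    -- by comparing the two.
    ⊛-sucʳ : ∀ f g n → (f ⊛ g) (suc n) ≈ f (suc n) * g 0 + (f ⊛ g ∘ suc) n
    ⊛-sucʳ f g zero    = +-comm _ _
    ⊛-sucʳ f g (suc n) = trans (+-congˡ (⊛-sucʳ (f ∘ suc) g n)) (x∙yz≈y∙xz _ _ _)

    ⊛-comm : ∀ f g → f ⊛ g ≋ g ⊛ f
    ⊛-comm f g zero    = *-comm _ _
    ⊛-comm f g (suc n) = trans (+-cong (*-comm _ _) (⊛-comm (f ∘ suc) g n)) (sym (⊛-sucʳ g f n))

    ⊛-assoc : ∀ f g h → (f ⊛ g) ⊛ h ≋ f ⊛ (g ⊛ h)
    ⊛-assoc f g h zero    = *-assoc _ _ _
    ⊛-assoc f g h (suc n) = begin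
      f 0 * g 0 * h (suc n) + (((λ i → f 0 * g (suc i)) ⊞ (f ∘ suc ⊛ g)) ⊛ h) n
        ≈⟨ +-cong (*-assoc _ _ _) (⊛-distribʳ h (λ i → f 0 * g (suc i)) (f ∘ suc ⊛ g) n) ⟩
      f 0 * (g 0 * h (suc n)) + (((λ i → f 0 * g (suc i)) ⊛ h) n + ((f ∘ suc ⊛ g) ⊛ h) n)
        ≈⟨ +-congˡ (+-cong (⊛-scaleˡ (f 0) (g ∘ suc) h n) (⊛-assoc (f ∘ suc) g h n)) ⟩
      f 0 * (g 0 * h (suc n)) + (f 0 * (g ∘ suc ⊛ h) n + (f ∘ suc ⊛ (g ⊛ h)) n)
        ≈⟨ +-assoc _ _ _ ⟨
      f 0 * (g 0 * h (suc n)) + f 0 * (g ∘ suc ⊛ h) n + (f ∘ suc ⊛ (g ⊛ h)) n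
        ≈⟨ +-congʳ (distribˡ _ _ _) ⟨
      f 0 * (g ⊛ h) (suc n) + (f ∘ suc ⊛ (g ⊛ h)) n ∎

    ⊛-distribˡ : ∀ h f g → h ⊛ (f ⊞ g) ≋ (h ⊛ f) ⊞ (h ⊛ g)
    ⊛-distribˡ h f g n = begin
      (h ⊛ (f ⊞ g)) n        ≈⟨ ⊛-comm h _ n ⟩
      ((f ⊞ g) ⊛ h) n        ≈⟨ ⊛-distribʳ h f g n ⟩
      (f ⊛ h) n + (g ⊛ h) n  ≈⟨ +-cong (⊛-comm f h n) (⊛-comm g h n) ⟩
      (h ⊛ f) n + (h ⊛ g) n  ∎

    ⊛-isCommutativeSemiring : IsCommutativeSemiring _≋_ _⊞_ _⊛_ 𝟎 𝟏
    ⊛-isCommutativeSemiring = record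
      { isSemiring = record
        { isSemiringWithoutAnnihilatingZero = record
          { +-isCommutativeMonoid = record
            { isMonoid = record
              { isSemigroup = record
                { isMagma = record
                  { isEquivalence = record
                    { refl  = λ _ → refl
                    ; sym   = λ p n → sym (p n)
                    ; trans = λ p q n → trans (p n) (q n) }
                  ; ∙-cong = λ p q n → +-cong (p n) (q n) }
                ; assoc = λ f g h n → +-assoc _ _ _ }
              ; identity = (λ f n → +-identityˡ _) , (λ f n → +-identityʳ _) }
            ; comm = λ f g n → +-comm _ _ }
          ; *-cong = ⊛-cong
          ; *-assoc = ⊛-assoc
          ; *-identity = ⊛-identityˡ , (λ f n → trans (⊛-comm f 𝟏 n) (⊛-identityˡ f n))
          ; distrib = ⊛-distribˡ , ⊛-distribʳ }
        ; zero = ⊛-zeroˡ , (λ f n → trans (⊛-comm f 𝟎 n) (⊛-zeroˡ f n)) }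
      ; *-comm = ⊛-comm }

    -- Being a commutative semiring again, it can serve as coefficients: two variables arise as
    -- series over series.
    series : CommutativeSemiring 0ℓ 0ℓ
    series = record { isCommutativeSemiring = ⊛-isCommutativeSemiring }

    private
      module Ser = CommutativeSemiring series
      module ∑S = Sums series
    open import Algebra.Definitions.RawMonoid +-rawMonoid using (_×_)
    open import Algebra.Definitions.RawMonoid Ser.+-rawMonoid using () renaming (_×_ to _×S_)

    ∑-coeff : ∀ {A : Set} (xs : List A) (f : A → Series) n →
              ∑S.∑ xs f n ≈ ∑ xs (λ x → f x n)
    ∑-coeff []       f n = refl
    ∑-coeff (x ∷ xs) f n = +-congˡ (∑-coeff xs f n)

    when-coeff : ∀ b (f : Series) n → ∑S.when b f n ≈ when b (f n)
    when-coeff true  f n = refl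
    when-coeff false f n = refl

    ×-coeff : ∀ m (f : Series) n → (m ×S f) n ≈ m × f n
    ×-coeff zero    f n = refl
    ×-coeff (suc m) f n = +-congˡ (×-coeff m f n)

    monomial : Carrier → ℕ → Series
    monomial a m n = when (m ≡ᵇ n) a

    monomial-* : ∀ a m b m′ → monomial a m ⊛ monomial b m′ ≋ monomial (a * b) (m ℕ.+ m′)
    monomial-* a zero b m′ zero    = when-*ˡ (m′ ≡ᵇ 0) a b
    monomial-* a zero b m′ (suc n) = trans
      (+-cong (when-*ˡ (m′ ≡ᵇ suc n) a b) (⊛-zeroˡ _ n)) (+-identityʳ _)
    monomial-* a (suc m) b m′ zero    = zeroˡ _
    monomial-* a (suc m) b m′ (suc n) = trans
      (+-cong (zeroˡ _) (monomial-* a m b m′ n)) (+-identityˡ _)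

  -- The multinomial theorem over strictly increasing indices

  module Multinomial (R : CommutativeSemiring 0ℓ 0ℓ)
                     (Q : ℕ → CommutativeSemiring.Carrier R) where
    open CommutativeSemiring R
    open Sums R
    open import Relation.Binary.Reasoning.Setoid setoid
    open import Algebra.Properties.Semiring.Exp semiring using (_^_; ^-congˡ)
    open import Algebra.Properties.Semiring.Mult semiring using (_×_; ×-congʳ; ×-assocˡ)
    open import Algebra.Properties.Semiring.Sum semiring using () renaming (sum to sumᶠ)
    import Algebra.Properties.CommutativeSemiring.Binomial R as Binomial

    ×-∑ : ∀ {A : Set} (xs : List A) m (f : A → Carrier) → m × ∑ xs f ≈ ∑ xs (λ x → m × f x)
    ×-∑ xs zero    f = sym (∑-zero xs (λ _ → refl))
    ×-∑ xs (suc m) f = trans (+-congˡ (×-∑ xs m f)) (sym (∑-+ xs _ _))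

    ×-when : ∀ b m x → m × when b x ≈ when b (m × x)
    ×-when true  m x = refl
    ×-when false zero x = refl
    ×-when false (suc m) x = trans (+-identityˡ _) (×-when false m x)

    ×-*ʳ : ∀ m a x → a * (m × x) ≈ m × (a * x)
    ×-*ʳ zero    a x = zeroʳ a
    ×-*ʳ (suc m) a x = trans (distribˡ _ _ _) (+-congˡ (×-*ʳ m a x))

    sumᶠ-∑< : ∀ n f → sumᶠ {n} (f ∘ toℕ) ≈ ∑< n f
    sumᶠ-∑< zero    f = refl
    sumᶠ-∑< (suc n) f = trans (+-congˡ (sumᶠ-∑< n (f ∘ suc))) (sym (∑<-suc n f))

    -- The term without x is set apart because an index occurring in the multinomial expansion
    -- carries an exponent of at least 1.
    binomial-theorem : ∀ r x y →
      (x + y) ^ r ≈ y ^ r + ∑< r (λ i → (r C suc i) × (x ^ suc i * y ^ (r ∸ suc i)))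
    binomial-theorem r x y = begin
      (x + y) ^ r                                               ≈⟨ Binomial.theorem r x y ⟩
      _
        ≈⟨ sumᶠ-∑< (suc r) (λ i → (r C i) × (x ^ i * y ^ (r ∸ i))) ⟩
      ∑< (suc r) (λ i → (r C i) × (x ^ i * y ^ (r ∸ i)))        ≈⟨ ∑<-suc r _ ⟩
      1 × (1# * y ^ r) + _                                      ≈⟨ +-congʳ (trans (+-identityʳ _) (*-identityˡ _)) ⟩
      y ^ r + ∑< r (λ i → (r C suc i) × (x ^ suc i * y ^ (r ∸ suc i)))  ∎

    powers : ∀ {m} → Vec ℕ m → Vec ℕ m → Carrier
    powers []       []       = 1#
    powers (r ∷ rs) (n ∷ ns) = Q n ^ r * powers rs ns

    module _ (r₀ N : ℕ) where

      -- The terms of the multinomial expansion with ℓ distinct indices from (b, N]: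
      -- prepending b to ns turns the monotonicity test into the lower bound as well.
      H : ℕ → ℕ → ℕ → Carrier
      H ℓ r b = ∑ (box ℓ r₀) λ rs → when (vsum rs ≡ᵇ r) (
                ∑ (box ℓ N)  λ ns → when (strictlyIncreasing (b ∷ ns)) (
                multinomial rs × powers rs ns))

      -- The tail Q (b + 1) + ⋯ + Q N, whose powers `H` expands; b = 0 gives the whole sum.
      G : ℕ → Carrier
      G b = ∑ (interval 1 N) λ y → when (b <ᵇ y) (Q y)

      H-zero : ∀ r b → H 0 r b ≈ when (0 ≡ᵇ r) 1#
      H-zero r b = trans (+-identityʳ _) (when-cong (0 ≡ᵇ r) (trans (+-identityʳ _) (+-identityʳ _)))

      private
        body : ∀ {ℓ} → ℕ → ℕ → Vec ℕ ℓ → ℕ → Vec ℕ ℓ → Carrier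
        body c s rs y ns = when (strictlyIncreasing (y ∷ ns)) ((c ℕ.* multinomial rs) × (Q y ^ s * powers rs ns))

        ×-assoc-*ʳ : ∀ c m a x → (c ℕ.* m) × (a * x) ≈ c × (a * (m × x))
        ×-assoc-*ʳ c m a x = trans (sym (×-assocˡ (a * x) c m)) (×-congʳ c (sym (×-*ʳ m a x)))

        -- With the smallest index y and its exponent s fixed, the remaining indices are exactly the
        -- increasing ones above y, so the rest is again an `H`, now with bound y.
        H-factor : ∀ ℓ c s r y →
          ∑ (box ℓ r₀) (λ rs → when (vsum rs ≡ᵇ r) (∑ (box ℓ N) (body c s rs y)))
            ≈ c × (Q y ^ s * H ℓ r y)
        H-factor ℓ c s r y = sym (begin
          c × (Q y ^ s * H ℓ r y)
            ≈⟨ ×-congʳ c (∑-*ˡ (box ℓ r₀) (Q y ^ s) _) ⟩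
          c × ∑ (box ℓ r₀) (λ rs → Q y ^ s * when (vsum rs ≡ᵇ r) (inn rs))
            ≈⟨ ×-∑ (box ℓ r₀) c _ ⟩
          ∑ (box ℓ r₀) (λ rs → c × (Q y ^ s * when (vsum rs ≡ᵇ r) (inn rs)))
            ≈⟨ ∑-cong (box ℓ r₀) (λ rs → trans (×-congʳ c (when-*ˡ (vsum rs ≡ᵇ r) _ _))
                 (trans (×-when (vsum rs ≡ᵇ r) c _) (when-cong (vsum rs ≡ᵇ r) (step rs)))) ⟩
          _ ∎)
          where
          inn : Vec ℕ ℓ → Carrier
          inn rs = ∑ (box ℓ N) λ ns → when (strictlyIncreasing (y ∷ ns)) (multinomial rs × powers rs ns)
          step : ∀ rs → c × (Q y ^ s * inn rs) ≈ ∑ (box ℓ N) (body c s rs y)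
          step rs = begin
            c × (Q y ^ s * inn rs)                ≈⟨ ×-congʳ c (∑-*ˡ (box ℓ N) _ _) ⟩
            _                                     ≈⟨ ×-∑ (box ℓ N) c _ ⟩
            _                                     ≈⟨ ∑-cong (box ℓ N) (λ ns → trans
              (×-congʳ c (when-*ˡ (strictlyIncreasing (y ∷ ns)) _ _))
              (trans (×-when (strictlyIncreasing (y ∷ ns)) c _)
                (when-cong (strictlyIncreasing (y ∷ ns)) (sym (×-assoc-*ʳ c _ _ _))))) ⟩
            ∑ (box ℓ N) (body c s rs y)           ∎

      private
        ins : ∀ ℓ → ℕ → ℕ → Vec ℕ ℓ → Carrier
        ins ℓ b s rs = ∑ (box (suc ℓ) N) λ ns →
          when (strictlyIncreasing (b ∷ ns)) (multinomial (s ∷ rs) × powers (s ∷ rs) ns)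

        ins-suc : ∀ ℓ b s (rs : Vec ℕ ℓ) → ins ℓ b s rs ≈
          ∑ (interval 1 N) λ y → when (b <ᵇ y) (∑ (box ℓ N) (body ((s ℕ.+ vsum rs) C s) s rs y))
        ins-suc ℓ b s rs = trans (∑-vecs ℓ (interval 1 N) _)
          (∑-cong (interval 1 N) λ y → trans
            (∑-cong (box ℓ N) λ ns → when-∧ (b <ᵇ y) _ _)
            (sym (∑-when (box ℓ N) (b <ᵇ y) _)))

        summand : ℕ → ℕ → ℕ → ℕ → ℕ → Carrier
        summand ℓ r b s y = when (b <ᵇ y) (when (s ≤ᵇ r) ((r C s) × (Q y ^ s * H ℓ (r ∸ s) y)))

        H-suc-s : ∀ ℓ r b s →
          ∑ (box ℓ r₀) (λ rs → when (s ℕ.+ vsum rs ≡ᵇ r) (ins ℓ b s rs))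
            ≈ ∑ (interval 1 N) (summand ℓ r b s)
        H-suc-s ℓ r b s = begin
          ∑ (box ℓ r₀) (λ rs → when (s ℕ.+ vsum rs ≡ᵇ r) (ins ℓ b s rs))
            -- Under the condition s + vsum rs = r the leading binomial factor becomes `r C s`,
            -- which no longer depends on `rs` and can leave the sum.
            ≈⟨ ∑-cong (box ℓ r₀) (λ rs → trans (when-cong-T (s ℕ.+ vsum rs ≡ᵇ r) (λ t →
                 trans (ins-suc ℓ b s rs) (reflexive (≡.cong
                   (λ r → ∑ (interval 1 N) (λ y → when (b <ᵇ y) (ext r rs y)))
                   (ℕₚ.≡ᵇ⇒≡ (s ℕ.+ vsum rs) r t)))))
                 (∑-when (interval 1 N) (s ℕ.+ vsum rs ≡ᵇ r) _)) ⟩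
          ∑ (box ℓ r₀) (λ rs → ∑ (interval 1 N) λ y → when (s ℕ.+ vsum rs ≡ᵇ r) (when (b <ᵇ y) (ext r rs y)))
            ≈⟨ ∑-swap (box ℓ r₀) (interval 1 N) _ ⟩
          ∑ (interval 1 N) (λ y → ∑ (box ℓ r₀) λ rs → when (s ℕ.+ vsum rs ≡ᵇ r) (when (b <ᵇ y) (ext r rs y)))
            ≈⟨ ∑-cong (interval 1 N) (λ y → trans
                 (∑-cong (box ℓ r₀) λ rs → trans (when-comm (s ℕ.+ vsum rs ≡ᵇ r) (b <ᵇ y) _)
                   (when-cong (b <ᵇ y) (trans (reflexive (≡.cong (λ t → when t (ext r rs y)) (+≡ᵇ s (vsum rs) r)))
                     (when-∧ (s ≤ᵇ r) (vsum rs ≡ᵇ r ∸ s) _))))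
                 (trans (sym (∑-when (box ℓ r₀) (b <ᵇ y) _)) (when-cong (b <ᵇ y)
                   (trans (sym (∑-when (box ℓ r₀) (s ≤ᵇ r) _)) (when-cong (s ≤ᵇ r)
                     (H-factor ℓ (r C s) s (r ∸ s) y)))))) ⟩
          ∑ (interval 1 N) (summand ℓ r b s) ∎
          where
          ext : ℕ → Vec ℕ ℓ → ℕ → Carrier
          ext r rs y = ∑ (box ℓ N) (body (r C s) s rs y)

      -- Takes out the smallest index y with its exponent s; `r C s` counts the ways to choose the s
      -- of the r factors that contribute `Q y`.
      H-suc : ∀ ℓ r b → H (suc ℓ) r b ≈
        ∑ (interval 1 r₀) λ s → ∑ (interval 1 N) λ y →
          when (b <ᵇ y) (when (s ≤ᵇ r) ((r C s) × (Q y ^ s * H ℓ (r ∸ s) y)))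
      H-suc ℓ r b = trans (∑-vecs ℓ (interval 1 r₀) _) (∑-cong (interval 1 r₀) (H-suc-s ℓ r b))

      private
        E : ℕ → ℕ → Carrier
        E r y = ∑ (interval 1 r₀) λ s → when (s ≤ᵇ r) ((r C s) × (Q y ^ s * G y ^ (r ∸ s)))

        tail : ℕ → (ℕ → Carrier) → Carrier
        tail b f = ∑ (interval 1 N) λ y → when (b <ᵇ y) (f y)

        tail-step : ∀ {b} f → b < N → tail b f ≈ f (suc b) + tail (suc b) f
        tail-step {b} f b<N = begin
          tail b f                                               ≈⟨ ∑-interval 1 N _ ⟩
          ∑< N (λ i → when (b <ᵇ suc i) (f (suc i)))             ≈⟨ ∑<-tail N b (f ∘ suc) b<N ⟩
          f (suc b) + ∑< N (λ i → when (suc b <ᵇ suc i) (f (suc i)))  ≈⟨ +-congˡ (∑-interval 1 N _) ⟨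
          f (suc b) + tail (suc b) f                             ∎

        tail-N : ∀ f → tail N f ≈ 0#
        tail-N f = trans (∑-interval 1 N _) (trans
          (∑<-cong N λ i i<N → reflexive (≡.cong (λ t → when t (f (suc i))) (<ᵇ-false i<N)))
          (∑-zero (upTo N) λ _ → refl))

        E-binomial : ∀ {r} y → r ≤ r₀ → G y ^ r + E r y ≈ (Q y + G y) ^ r
        E-binomial {r} y r≤r₀ = trans
          (+-congˡ (trans (∑-interval 1 r₀ _) (∑<-restrict _ r≤r₀)))
          (sym (binomial-theorem r (Q y) (G y)))

        0^ : ∀ r → 0# ^ r ≈ when (0 ≡ᵇ r) 1#
        0^ zero    = refl
        0^ (suc r) = zeroˡ _

        -- Splitting the index b + 1 off G b adds E r (b + 1), by the binomial theorem.
        telescope : ∀ {r} → r ≤ r₀ → ∀ g b → b ℕ.+ g ≡ N → when (0 ≡ᵇ r) 1# + tail b (E r) ≈ G b ^ r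
        telescope {r} r≤r₀ zero b eq with ≡.refl ← ≡.trans (≡.sym (ℕₚ.+-identityʳ b)) eq = begin
          when (0 ≡ᵇ r) 1# + tail N (E r)  ≈⟨ +-congˡ (tail-N _) ⟩
          when (0 ≡ᵇ r) 1# + 0#            ≈⟨ +-identityʳ _ ⟩
          when (0 ≡ᵇ r) 1#                 ≈⟨ 0^ r ⟨
          0# ^ r                           ≈⟨ ^-congˡ r (tail-N Q) ⟨
          G N ^ r                          ∎
        telescope {r} r≤r₀ (suc g) b eq = begin
          when (0 ≡ᵇ r) 1# + tail b (E r)                          ≈⟨ +-congˡ (tail-step (E r) b<N) ⟩
          when (0 ≡ᵇ r) 1# + (E r (suc b) + tail (suc b) (E r))    ≈⟨ +-congˡ (+-comm _ _) ⟩
          when (0 ≡ᵇ r) 1# + (tail (suc b) (E r) + E r (suc b))    ≈⟨ +-assoc _ _ _ ⟨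
          when (0 ≡ᵇ r) 1# + tail (suc b) (E r) + E r (suc b)      ≈⟨ +-congʳ (telescope r≤r₀ g (suc b) eq′) ⟩
          G (suc b) ^ r + E r (suc b)                              ≈⟨ E-binomial (suc b) r≤r₀ ⟩
          (Q (suc b) + G (suc b)) ^ r                              ≈⟨ ^-congˡ r (tail-step Q b<N) ⟨
          G b ^ r                                                  ∎
          where
          eq′ : suc b ℕ.+ g ≡ N
          eq′ = ≡.trans (≡.sym (ℕₚ.+-suc b g)) eq
          b<N : b < N
          b<N = ≡.subst (suc b ≤_) eq′ (ℕₚ.m≤m+n (suc b) g)

      -- Induction on `L`. Taking out the smallest index y with exponent s ≥ 1 leaves a smaller
      -- exponent r ∸ s and indices above y, where the hypothesis yields `G y ^ (r ∸ s)`. What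
      -- remains is `E r y` summed over y > b, which telescopes. The bound r < L makes room for up
      -- to r distinct indices, the most that positive exponents of sum r allow.
      multinomial-tail : ∀ L {r} b → r < L → r ≤ r₀ → b ≤ N → ∑< L (λ ℓ → H ℓ r b) ≈ G b ^ r
      multinomial-tail (suc L) {r} b r<1+L r≤r₀ b≤N = begin
        ∑< (suc L) (λ ℓ → H ℓ r b)
          ≈⟨ ∑<-suc L _ ⟩
        H 0 r b + ∑< L (λ ℓ → H (suc ℓ) r b)
          ≈⟨ +-cong (H-zero r b) (∑-cong (upTo L) λ ℓ → H-suc ℓ r b) ⟩
        _ ≈⟨ +-congˡ (∑-swap (upTo L) (interval 1 r₀) _) ⟩
        _ ≈⟨ +-congˡ (∑-cong (interval 1 r₀) λ s → ∑-swap (upTo L) (interval 1 N) _) ⟩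
        _ ≈⟨ +-congˡ (trans (∑-interval 1 r₀ _) (trans
               (∑-cong (upTo r₀) λ i → trans (∑-interval 1 N _) (trans
                 (∑<-cong N λ j j<N → collect i (suc j) j<N) (sym (∑-interval 1 N _))))
               (sym (∑-interval 1 r₀ _)))) ⟩
        _ ≈⟨ +-congˡ (∑-swap (interval 1 r₀) (interval 1 N) _) ⟩
        _ ≈⟨ +-congˡ (∑-cong (interval 1 N) λ y → sym (∑-when (interval 1 r₀) (b <ᵇ y) _)) ⟩
        when (0 ≡ᵇ r) 1# + tail b (E r)
          ≈⟨ telescope r≤r₀ (N ∸ b) b (ℕₚ.m+[n∸m]≡n b≤N) ⟩
        G b ^ r ∎
        where
        collect : ∀ i y → y ≤ N →
          ∑< L (λ ℓ → when (b <ᵇ y) (when (suc i ≤ᵇ r) ((r C suc i) × (Q y ^ suc i * H ℓ (r ∸ suc i) y))))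
          ≈ when (b <ᵇ y) (when (suc i ≤ᵇ r) ((r C suc i) × (Q y ^ suc i * G y ^ (r ∸ suc i))))
        collect i y y≤N = begin
          _ ≈⟨ ∑-when (upTo L) (b <ᵇ y) _ ⟨
          _ ≈⟨ when-cong (b <ᵇ y) (sym (∑-when (upTo L) (suc i ≤ᵇ r) _)) ⟩
          _ ≈⟨ when-cong (b <ᵇ y) (when-cong-T (suc i ≤ᵇ r) λ t → trans (sym (×-∑ (upTo L) (r C suc i) _))
               (×-congʳ (r C suc i) (trans (sym (∑-*ˡ (upTo L) _ _)) (*-congˡ
                 (multinomial-tail L y (ℕₚ.<-≤-trans (lt (ℕₚ.≤ᵇ⇒≤ (suc i) r t)) (ℕₚ.≤-pred r<1+L))
                   (ℕₚ.≤-trans (ℕₚ.m∸n≤m r (suc i)) r≤r₀) y≤N))))) ⟩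
          _ ∎
          where
          lt : suc i ≤ r → r ∸ suc i < r
          lt (s≤s {n = r′} _) = s≤s (ℕₚ.m∸n≤m r′ i)

-- Cutting permutations at their first block

module BlockDecomposition where
  open PermutationGraphs
  open GeneratingFunctions
  open import Algebra.Bundles using (CommutativeSemiring)
  open import Data.Bool using (Bool; true; false; _∧_; _∨_; not; T)
  import Data.Bool.Properties as 𝔹ₚ
  open import Data.Fin as Fin using (Fin; suc; toℕ; _↑ˡ_; _↑ʳ_)
  open import Data.List using (List; allFin; upTo)
  import Data.List.Properties as Listₚ
  open import Data.Nat as ℕ using (zero; suc; _∸_; _<ᵇ_; s≤s)
  import Data.Nat.Properties as ℕₚ
  open import Data.Vec as Vec using (Vec; []; _∷_; lookup; _++_)
  import Data.Vec.Properties as Vecₚ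
  open import Function using (_∘_; id)
  open import Level using (0ℓ)
  import Relation.Binary.PropositionalEquality as ≡
  open import Relation.Nullary using (¬_; contradiction)

  -- The index is shifted: i + 1 is the size of the shortest nonempty block.
  firstBlock : ∀ {n} → Vec (Fin n) n → ℕ → Bool
  firstBlock v i = block v (suc i) ∧ not (anyBelow (block v ∘ suc) i)

  vecs : ∀ n → List (Vec (Fin n) n)
  vecs n = vecsOver n (allFin n)

  -- The decomposition holds for every weight multiplicative over direct sums; the weight used later
  -- is y to the power of the domination number.
  module Decomposition (R : CommutativeSemiring 0ℓ 0ℓ)
    (ω : ∀ {n} → Vec (Fin n) n → CommutativeSemiring.Carrier R)
    (ω-⊕ : ∀ {m p} (σ : Vec (Fin m) m) (τ : Vec (Fin p) p) →
           CommutativeSemiring._≈_ R (ω (σ ⊕ τ)) (CommutativeSemiring._*_ R (ω σ) (ω τ))) where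
    open CommutativeSemiring R
    open Sums R
    open import Relation.Binary.Reasoning.Setoid setoid

    -- Sums over all vectors, with injectivity as an indicator: this index set splits along
    -- concatenation.
    gfᵃ gfᶜ gfᵈ : ℕ → Carrier
    gfᵃ n = ∑ (vecs n) λ π → when (injective π) (ω π)
    gfᶜ n = ∑ (vecs n) λ π → when (injective π) (when (connected π) (ω π))
    gfᵈ n = ∑ (vecs n) λ π → when (injective π) (when (not (connected π)) (ω π))

    gfᵃ-split : ∀ n → gfᵃ n ≈ gfᶜ n + gfᵈ n
    gfᵃ-split n = trans
      (∑-cong (vecs n) λ π → trans (when-cong (injective π) (either (connected π) (ω π)))
        (when-+ (injective π) _ _))
      (∑-+ (vecs n) _ _)
      where
      either : ∀ b x → x ≈ when b x + when (not b) x
      either true  x = sym (+-identityʳ x)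
      either false x = sym (+-identityˡ x)

    ∑-vecs-++ : ∀ {A : Set} a b (xs : List A) (f : Vec A (a ℕ.+ b) → Carrier) →
      ∑ (vecsOver (a ℕ.+ b) xs) f ≈ ∑ (vecsOver a xs) λ u → ∑ (vecsOver b xs) λ w → f (u ++ w)
    ∑-vecs-++ zero    b xs f = sym (+-identityʳ _)
    ∑-vecs-++ (suc a) b xs f = begin
      ∑ (vecsOver (suc a ℕ.+ b) xs) f
        ≈⟨ ∑-vecs (a ℕ.+ b) xs f ⟩
      ∑ xs (λ x → ∑ (vecsOver (a ℕ.+ b) xs) λ v → f (x ∷ v))
        ≈⟨ ∑-cong xs (λ x → ∑-vecs-++ a b xs (λ v → f (x ∷ v))) ⟩
      ∑ xs (λ x → ∑ (vecsOver a xs) λ u → ∑ (vecsOver b xs) λ w → f (x ∷ u ++ w))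
        ≈⟨ ∑-vecs a xs _ ⟨
      ∑ (vecsOver (suc a) xs) (λ u → ∑ (vecsOver b xs) λ w → f (u ++ w)) ∎

    -- Splitting the range of each entry into the images of `e` and `e′`, any vector with an entry
    -- in the second image contributes 0. For a cut, `e` embeds the values on the proper side and
    -- `e′` those on the other.
    ∑-vecs-support : ∀ {A B C : Set} (xs : List A) (ys : List B) (zs : List C) (e : B → A) (e′ : C → A) →
      (∀ h → ∑ xs h ≈ ∑ ys (h ∘ e) + ∑ zs (h ∘ e′)) →
      ∀ a (f : Vec A a → Carrier) → (∀ u i z → lookup u i ≡ e′ z → f u ≈ 0#) →
      ∑ (vecsOver a xs) f ≈ ∑ (vecsOver a ys) (f ∘ Vec.map e)
    ∑-vecs-support xs ys zs e e′ split zero    f supp = refl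
    ∑-vecs-support xs ys zs e e′ split (suc a) f supp = begin
      ∑ (vecsOver (suc a) xs) f
        ≈⟨ ∑-vecs a xs f ⟩
      ∑ xs (λ x → ∑ (vecsOver a xs) λ v → f (x ∷ v))
        ≈⟨ split _ ⟩
      ∑ ys (λ y → ∑ (vecsOver a xs) λ v → f (e y ∷ v)) + ∑ zs (λ z → ∑ (vecsOver a xs) λ v → f (e′ z ∷ v))
        ≈⟨ +-congˡ (∑-zero zs λ z → ∑-zero (vecsOver a xs) λ v → supp (e′ z ∷ v) Fin.zero z ≡.refl) ⟩
      ∑ ys (λ y → ∑ (vecsOver a xs) λ v → f (e y ∷ v)) + 0#
        ≈⟨ +-identityʳ _ ⟩
      ∑ ys (λ y → ∑ (vecsOver a xs) λ v → f (e y ∷ v))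
        ≈⟨ ∑-cong ys (λ y → ∑-vecs-support xs ys zs e e′ split a (λ v → f (e y ∷ v))
             (λ u i z eq → supp (e y ∷ u) (suc i) z eq)) ⟩
      ∑ ys (λ y → ∑ (vecsOver a ys) λ v → f (e y ∷ Vec.map e v))
        ≈⟨ ∑-vecs a ys _ ⟨
      ∑ (vecsOver (suc a) ys) (f ∘ Vec.map e) ∎

    ∑-allFin-suc : ∀ n (f : Fin (suc n) → Carrier) → ∑ (allFin (suc n)) f ≈ f Fin.zero + ∑ (allFin n) (f ∘ suc)
    ∑-allFin-suc n f = +-congˡ (trans
      (reflexive (≡.cong (λ xs → ∑ xs f) (≡.sym (Listₚ.map-tabulate id suc))))
      (∑-map suc (allFin n) f))

    ∑-allFin-+ : ∀ m p (f : Fin (m ℕ.+ p) → Carrier) →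
      ∑ (allFin (m ℕ.+ p)) f ≈ ∑ (allFin m) (f ∘ (_↑ˡ p)) + ∑ (allFin p) (f ∘ (m ↑ʳ_))
    ∑-allFin-+ zero    p f = sym (+-identityˡ _)
    ∑-allFin-+ (suc m) p f = begin
      ∑ (allFin (suc m ℕ.+ p)) f
        ≈⟨ ∑-allFin-suc (m ℕ.+ p) f ⟩
      f Fin.zero + ∑ (allFin (m ℕ.+ p)) (f ∘ suc)
        ≈⟨ +-congˡ (∑-allFin-+ m p (f ∘ suc)) ⟩
      f Fin.zero + (∑ (allFin m) (f ∘ suc ∘ (_↑ˡ p)) + ∑ (allFin p) (f ∘ (suc m ↑ʳ_)))
        ≈⟨ +-assoc _ _ _ ⟨
      f Fin.zero + ∑ (allFin m) (f ∘ suc ∘ (_↑ˡ p)) + ∑ (allFin p) (f ∘ (suc m ↑ʳ_))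
        ≈⟨ +-congʳ (∑-allFin-suc m (f ∘ (_↑ˡ p))) ⟨
      ∑ (allFin (suc m)) (f ∘ (_↑ˡ p)) + ∑ (allFin p) (f ∘ (suc m ↑ʳ_)) ∎

    -- Stands in for the bijection between vectors with block m and pairs (σ, τ): a nonzero summand
    -- forces the first m entries below m and the other entries to be at least m.
    ∑-blocks : ∀ m p (f : Vec (Fin (m ℕ.+ p)) (m ℕ.+ p) → Carrier) → (∀ v → ¬ Block v m → f v ≈ 0#) →
      ∑ (vecs (m ℕ.+ p)) f ≈ ∑ (vecs m) λ σ → ∑ (vecs p) λ τ → f (σ ⊕ τ)
    ∑-blocks m p f supp = begin
      ∑ (vecs (m ℕ.+ p)) f
        ≈⟨ ∑-vecs-++ m p (allFin (m ℕ.+ p)) f ⟩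
      ∑ (vecsOver m F) (λ u → ∑ (vecsOver p F) λ w → f (u ++ w))
        ≈⟨ ∑-vecs-support F (allFin m) (allFin p) (_↑ˡ p) (m ↑ʳ_) (∑-allFin-+ m p) m _
             (λ u i z eq → ∑-zero (vecsOver p F) λ w → supp (u ++ w) λ blk → contradiction
               (≡.trans (≡.sym (<ᵇ-↑ˡ i p)) (≡.trans (blk (i ↑ˡ p)) (≡.trans
                 (≡.cong (λ x → toℕ x <ᵇ m) (≡.trans (Vecₚ.lookup-++ˡ u w i) eq)) (<ᵇ-↑ʳ m z)))) λ ()) ⟩
      ∑ (vecs m) (λ σ → ∑ (vecsOver p F) λ w → f (Vec.map (_↑ˡ p) σ ++ w))
        ≈⟨ ∑-cong (vecs m) (λ σ → ∑-vecs-support F (allFin p) (allFin m) (m ↑ʳ_) (_↑ˡ p)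
             (λ h → trans (∑-allFin-+ m p h) (+-comm _ _)) p _
             (λ w i z eq → supp (Vec.map (_↑ˡ p) σ ++ w) λ blk → contradiction
               (≡.trans (≡.sym (<ᵇ-↑ˡ z p)) (≡.trans
                 (≡.cong (λ x → toℕ x <ᵇ m) (≡.sym (≡.trans (Vecₚ.lookup-++ʳ (Vec.map (_↑ˡ p) σ) w i) eq)))
                 (≡.trans (≡.sym (blk (m ↑ʳ i))) (<ᵇ-↑ʳ m i)))) λ ())) ⟩
      ∑ (vecs m) (λ σ → ∑ (vecs p) λ τ → f (σ ⊕ τ)) ∎
      where
      F = allFin (m ℕ.+ p)

    -- If `b` holds anywhere below n there is exactly one least such index, so exactly one indicator
    -- on the right is nonzero.
    firstBlock-∑ : ∀ b n x → when (anyBelow b n) x ≈ ∑< n λ i → when (b i ∧ not (anyBelow b i)) x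
    firstBlock-∑ b zero    x = refl
    firstBlock-∑ b (suc n) x = sym (begin
      ∑< (suc n) (λ i → when (b i ∧ not (anyBelow b i)) x)      ≈⟨ ∑<-last n _ ⟩
      _ + when (b n ∧ not (anyBelow b n)) x                     ≈⟨ +-congʳ (firstBlock-∑ b n x) ⟨
      when (anyBelow b n) x + when (b n ∧ not (anyBelow b n)) x ≈⟨ cases (anyBelow b n) (b n) ⟩
      when (anyBelow b n ∨ b n) x                               ∎)
      where
      cases : ∀ s t → when s x + when (t ∧ not s) x ≈ when (s ∨ t) x
      cases true  true  = +-identityʳ x
      cases true  false = +-identityʳ x
      cases false true  = +-identityˡ x
      cases false false = +-identityˡ 0#

    -- The cut between the summands is a block, and the shorter blocks are those of `σ`. So it is
    -- the first one exactly when `σ` has no proper block, that is, when `σ` is connected.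
    firstBlock-⊕ : ∀ {i p} (σ : Vec (Fin (suc i)) (suc i)) (τ : Vec (Fin p) p) → T (injective σ) →
      firstBlock (σ ⊕ τ) i ≡ connected σ
    firstBlock-⊕ {i} σ τ inj = ≡.trans
      (≡.cong₂ (λ b t → b ∧ not t)
        (T⇒true (does⇐ (block? (σ ⊕ τ) (suc i)) (Block-⊕ σ τ)))
        (≡.trans (anyBelow-cong i λ j j<i → block-⊕ σ τ {suc j} (s≤s (ℕₚ.<⇒≤ j<i))) (≡.sym (not-connected σ inj))))
      (𝔹ₚ.not-involutive (connected σ))

    -- The size enters through an equation, so matching it with `refl` spares any cast of vectors
    -- from size suc i + p to size n.
    ∑-firstBlock : ∀ {n} i p → suc i ℕ.+ p ≡ n →
      ∑ (vecs n) (λ π → when (injective π) (when (firstBlock π i) (ω π))) ≈ gfᶜ (suc i) * gfᵃ p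
    ∑-firstBlock i p ≡.refl = begin
      ∑ (vecs (m ℕ.+ p)) (λ π → when (injective π) (when (firstBlock π i) (ω π)))
        ≈⟨ ∑-blocks m p (λ π → when (injective π) (when (firstBlock π i) (ω π))) 
             (λ v ¬blk → trans (when-cong (injective v) (when-false
               (≡.cong (_∧ not (anyBelow (block v ∘ suc) i))
                 (¬T⇒false λ t → ¬blk (does⇒ (block? v m) t)))))
               (when-zero (injective v))) ⟩
      ∑ (vecs m) (λ σ → ∑ (vecs p) λ τ → when (injective (σ ⊕ τ)) (when (firstBlock (σ ⊕ τ) i) (ω (σ ⊕ τ))))
        ≈⟨ ∑-cong (vecs m) (λ σ → ∑-cong (vecs p) λ τ → term σ τ) ⟩
      ∑ (vecs m) (λ σ → ∑ (vecs p) λ τ → F σ * when (injective τ) (ω τ))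
        ≈⟨ ∑-cong (vecs m) (λ σ → ∑-*ˡ (vecs p) (F σ) _) ⟨
      ∑ (vecs m) (λ σ → F σ * gfᵃ p)
        ≈⟨ ∑-*ʳ (vecs m) (gfᵃ p) F ⟨
      gfᶜ m * gfᵃ p ∎
      where
      m = suc i
      F : Vec (Fin m) m → Carrier
      F σ = when (injective σ) (when (connected σ) (ω σ))
      term : ∀ σ τ → when (injective (σ ⊕ τ)) (when (firstBlock (σ ⊕ τ) i) (ω (σ ⊕ τ))) ≈
             F σ * when (injective τ) (ω τ)
      term σ τ = begin
        when (injective (σ ⊕ τ)) (when (firstBlock (σ ⊕ τ) i) (ω (σ ⊕ τ)))
          ≈⟨ reflexive (≡.cong (λ b → when b (when (firstBlock (σ ⊕ τ) i) (ω (σ ⊕ τ)))) (injective-⊕ σ τ)) ⟩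
        when (injective σ ∧ injective τ) (when (firstBlock (σ ⊕ τ) i) (ω (σ ⊕ τ)))
          ≈⟨ when-∧ (injective σ) (injective τ) _ ⟩
        when (injective σ) (when (injective τ) (when (firstBlock (σ ⊕ τ) i) (ω (σ ⊕ τ))))
          ≈⟨ when-cong-T (injective σ) (λ inj → when-cong (injective τ) (trans
               (reflexive (≡.cong (λ b → when b (ω (σ ⊕ τ))) (firstBlock-⊕ σ τ inj)))
               (when-cong (connected σ) (ω-⊕ σ τ)))) ⟩
        when (injective σ) (when (injective τ) (when (connected σ) (ω σ * ω τ)))
          ≈⟨ when-cong (injective σ) (when-comm (injective τ) (connected σ) _) ⟩
        when (injective σ) (when (connected σ) (when (injective τ) (ω σ * ω τ)))
          ≈⟨ when-cong (injective σ) (when-cong (connected σ) (when-*ˡ (injective τ) _ _)) ⟨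
        when (injective σ) (when (connected σ) (ω σ * when (injective τ) (ω τ)))
          ≈⟨ when-cong (injective σ) (when-*ʳ (connected σ) _ _) ⟨
        when (injective σ) (when (connected σ) (ω σ) * when (injective τ) (ω τ))
          ≈⟨ when-*ʳ (injective σ) _ _ ⟨
        F σ * when (injective τ) (ω τ) ∎

    -- The range i < n keeps the second summand, of size n ∸ i, nonempty.
    gfᵈ-recurrence : ∀ n → gfᵈ (suc n) ≈ ∑< n λ i → gfᶜ (suc i) * gfᵃ (n ∸ i)
    gfᵈ-recurrence n = begin
      gfᵈ (suc n)
        ≈⟨ ∑-cong (vecs (suc n)) (λ π → trans
             (when-cong-T (injective π) λ inj → trans
               (reflexive (≡.cong (λ b → when b (ω π)) (not-connected π inj)))
               (firstBlock-∑ (block π ∘ suc) n (ω π)))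
             (∑-when (upTo n) (injective π) _)) ⟩
      ∑ (vecs (suc n)) (λ π → ∑< n λ i → when (injective π) (when (firstBlock π i) (ω π)))
        ≈⟨ ∑-swap (vecs (suc n)) (upTo n) _ ⟩
      ∑< n (λ i → ∑ (vecs (suc n)) λ π → when (injective π) (when (firstBlock π i) (ω π)))
        ≈⟨ ∑<-cong n (λ i i<n → ∑-firstBlock i (n ∸ i) (≡.cong suc (ℕₚ.m+[n∸m]≡n (ℕₚ.<⇒≤ i<n)))) ⟩
      ∑< n (λ i → gfᶜ (suc i) * gfᵃ (n ∸ i)) ∎

open PermutationGraphs using (_⊕_; dominationNumber-⊕; dominationNumber-positive)
open GeneratingFunctions
open BlockDecomposition
open import Algebra.Bundles using (CommutativeSemiring)
open import Data.Bool using (Bool; true; false; _∧_; not; T)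
open import Data.Empty using (⊥-elim)
open import Data.Fin using (Fin)
open import Data.List using (List; []; _∷_; filterᵇ; length; upTo)
open import Data.List.Relation.Unary.All as LAll using (All)
import Data.List.Relation.Unary.All.Properties as LAllₚ
open import Data.Nat as ℕ using (zero; suc; _+_; _*_; _∸_; _<_; _≤ᵇ_; _<ᵇ_; _≡ᵇ_; z≤n; s≤s)
import Data.Nat.Properties as ℕₚ
open import Data.Vec as Vec using (Vec; []; _∷_; replicate; zipWith)
import Data.Vec.Relation.Unary.All as VAll
open import Function using (_∘_)
open import Level using (0ℓ)
open import Relation.Binary.PropositionalEquality
  using (_≢_; refl; sym; trans; cong; cong₂; subst; subst₂; module ≡-Reasoning)
open import Relation.Nullary using (yes; no)

-- The bivariate generating functions

ℕ-semiring : CommutativeSemiring 0ℓ 0ℓ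
ℕ-semiring = ℕₚ.+-*-commutativeSemiring

-- Series in y, marking the domination number, and over them series in x, marking the size.
module Y = PowerSeries ℕ-semiring
module YS = CommutativeSemiring Y.series
module X = PowerSeries Y.series
module XS = CommutativeSemiring X.series

open Sums ℕ-semiring
private
  module ∑Y = Sums Y.series
  module ∑X = Sums X.series
open import Algebra.Properties.Semiring.Exp XS.semiring using () renaming (_^_ to _^X_)
open import Algebra.Properties.Semiring.Exp YS.semiring using () renaming (_^_ to _^Y_)
open import Algebra.Definitions.RawMonoid (CommutativeSemiring.+-rawMonoid ℕ-semiring) using (_×_)

∑-coeff₂ : ∀ {A : Set} (xs : List A) (f : A → X.Series) n k →
  ∑X.∑ xs f n k ≡ ∑ xs (λ x → f x n k)
∑-coeff₂ xs f n k = trans (X.∑-coeff xs f n k) (Y.∑-coeff xs (λ x → f x n) k)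

when-coeff₂ : ∀ b (f : X.Series) n k → ∑X.when b f n k ≡ when b (f n k)
when-coeff₂ b f n k = trans (X.when-coeff b f n k) (Y.when-coeff b (f n) k)

×≡* : ∀ m x → m × x ≡ m * x
×≡* zero    x = refl
×≡* (suc m) x = cong (x +_) (×≡* m x)

module Geometric (R : CommutativeSemiring 0ℓ 0ℓ) where
  private module ∑R = Sums R
  open CommutativeSemiring R renaming (_+_ to _⊞_; _*_ to _⊛_; refl to ≈-refl; sym to ≈-sym; trans to ≈-trans)
  open import Algebra.Properties.Semiring.Exp semiring using (_^_)
  open import Relation.Binary.Reasoning.Setoid setoid

  -- Keeping the remainder `a ^ t ⊛ x` makes this a finite identity, free of convergence and of
  -- inverses.
  geometric : ∀ a x → x ≈ a ⊛ a ⊞ a ⊛ x → ∀ t →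
              x ≈ ∑R.∑< t (λ i → a ^ suc (suc i)) ⊞ a ^ t ⊛ x
  geometric a x eq zero    = ≈-sym (≈-trans (+-identityˡ _) (*-identityˡ x))
  geometric a x eq (suc t) = begin
    x                                                      ≈⟨ geometric a x eq t ⟩
    S ⊞ a ^ t ⊛ x                                          ≈⟨ +-congˡ (*-congˡ eq) ⟩
    S ⊞ a ^ t ⊛ (a ⊛ a ⊞ a ⊛ x)                            ≈⟨ +-congˡ (distribˡ _ _ _) ⟩
    S ⊞ (a ^ t ⊛ (a ⊛ a) ⊞ a ^ t ⊛ (a ⊛ x))                ≈⟨ +-congˡ (+-cong
      (≈-trans (*-comm _ _) (*-assoc _ _ _)) (≈-trans (≈-sym (*-assoc _ _ _)) (*-congʳ (*-comm _ _)))) ⟩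
    S ⊞ (a ^ suc (suc t) ⊞ a ^ suc t ⊛ x)                  ≈⟨ +-assoc _ _ _ ⟨
    S ⊞ a ^ suc (suc t) ⊞ a ^ suc t ⊛ x                    ≈⟨ +-congʳ (∑R.∑<-last t _) ⟨
    ∑R.∑< (suc t) (λ i → a ^ suc (suc i)) ⊞ a ^ suc t ⊛ x  ∎
    where
    S : Carrier
    S = ∑R.∑< t (λ i → a ^ suc (suc i))

ω : ∀ {n} → Vec (Fin n) n → Y.Series
ω π = Y.monomial 1 (dominationNumber π)

ω-⊕ : ∀ {m p} (σ : Vec (Fin m) m) (τ : Vec (Fin p) p) → ω (σ ⊕ τ) YS.≈ ω σ YS.* ω τ
ω-⊕ σ τ k = trans
  (cong (λ e → Y.monomial 1 e k) (dominationNumber-⊕ σ τ))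
  (sym (Y.monomial-* 1 (dominationNumber σ) 1 (dominationNumber τ) k))

open Decomposition Y.series ω ω-⊕

length≡∑ : ∀ {A : Set} (xs : List A) → length xs ≡ ∑ xs λ _ → 1
length≡∑ []       = refl
length≡∑ (x ∷ xs) = cong suc (length≡∑ xs)

-- The test `dominationNumber π ≡ᵇ k` is the coefficient of yᵏ in the monomial `ω π`, so counting at
-- fixed k is reading off a coefficient.
count-perms : ∀ n k (p : Vec (Fin n) n → Bool) →
  length (filterᵇ (λ π → p π ∧ (dominationNumber π ≡ᵇ k)) (perms n)) ≡
  ∑Y.∑ (vecs n) (λ π → ∑Y.when (injective π) (∑Y.when (p π) (ω π))) k
count-perms n k p = begin
  length (filterᵇ q (perms n))
    ≡⟨ trans (length≡∑ (filterᵇ q (perms n))) (∑-filter (perms n) q _) ⟩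
  ∑ (perms n) (λ π → when (q π) 1)
    ≡⟨ ∑-filter (vecs n) injective _ ⟩
  ∑ (vecs n) (λ π → when (injective π) (when (q π) 1))
    ≡⟨ ∑-cong (vecs n) (λ π → sym (trans (Y.when-coeff (injective π) _ k)
         (when-cong (injective π) (trans (Y.when-coeff (p π) (ω π) k) (sym (when-∧ (p π) _ 1)))))) ⟩
  ∑ (vecs n) (λ π → ∑Y.when (injective π) (∑Y.when (p π) (ω π)) k)
    ≡⟨ Y.∑-coeff (vecs n) _ k ⟨
  _ ∎
  where
  open ≡-Reasoning
  q : Vec (Fin n) n → Bool
  q π = p π ∧ (dominationNumber π ≡ᵇ k)

c≡gfᶜ : ∀ n → c n YS.≈ gfᶜ n
c≡gfᶜ n k = count-perms n k connected

d≡gfᵈ : ∀ n → d n YS.≈ gfᵈ n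
d≡gfᵈ n k = count-perms n k (not ∘ connected)

-- Divisibility by powers of y

Order : ℕ → Y.Series → Set
Order t f = ∀ k → k < t → f k ≡ 0

-- If k < s + t, every term f i * g (k ∸ i) has i < s or k ∸ i < t.
Order-⊛ : ∀ {s t f g} → Order s f → Order t g → Order (s + t) (f Y.⊛ g)
Order-⊛ {s} {t} {f} {g} of og k k<s+t = trans (Y.⊛-∑ k f g)
  (trans (∑<-cong (suc k) term) (∑-zero (upTo (suc k)) λ _ → refl))
  where
  term : ∀ i → i < suc k → f i * g (k ∸ i) ≡ 0
  term i (s≤s i≤k) with i ℕ.<? s
  ... | yes i<s = cong (_* g (k ∸ i)) (of i i<s)
  ... | no  i≮s = trans (cong (f i *_) (og (k ∸ i) k∸i<t)) (ℕₚ.*-zeroʳ (f i))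
    where
    k∸i<t : k ∸ i < t
    k∸i<t = ℕₚ.+-cancelˡ-< i _ _ (ℕₚ.<-≤-trans
      (subst (_< s + t) (sym (ℕₚ.m+[n∸m]≡n i≤k)) k<s+t) (ℕₚ.+-monoˡ-≤ t (ℕₚ.≮⇒≥ i≮s)))

Order-^ : ∀ {s f} → Order s f → ∀ t → Order (t * s) (f ^Y t)
Order-^ of zero    k ()
Order-^ {f = f} of (suc t) = Order-⊛ {f = f} of (Order-^ of t)

-- Order in y only, uniformly over the coefficients in x.
OrderX : ℕ → X.Series → Set
OrderX t f = ∀ n → Order t (f n)

OrderX-⊛ : ∀ {s t f g} → OrderX s f → OrderX t g → OrderX (s + t) (f X.⊛ g)
OrderX-⊛ {f = f} {g} of og n k k< = trans (X.⊛-∑ n f g k) (trans (Y.∑-coeff (upTo (suc n)) _ k)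
  (∑-zero (upTo (suc n)) λ i → Order-⊛ {f = f i} {g (n ∸ i)} (of i) (og (n ∸ i)) k k<))

OrderX-^ : ∀ {s f} → OrderX s f → ∀ t → OrderX (t * s) (f ^X t)
OrderX-^ of zero    n k ()
OrderX-^ {f = f} of (suc t) = OrderX-⊛ {f = f} of (OrderX-^ of t)

c-Order : ∀ n → Order 1 (c (suc n))
c-Order n zero _ = trans (c≡gfᶜ (suc n) 0) (trans (Y.∑-coeff (vecs (suc n)) _ 0)
  (∑-zero (vecs (suc n)) λ π → trans (Y.when-coeff (injective π) _ 0) (trans
    (when-cong (injective π) (trans (Y.when-coeff (connected π) (ω π) 0) (trans
      (when-cong (connected π) (when-false (≢0⇒ (dominationNumber-positive π))))
      (when-zero (connected π)))))
    (when-zero (injective π)))))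
  where
  ≢0⇒ : ∀ {m} → m ≢ 0 → (m ≡ᵇ 0) ≡ false
  ≢0⇒ {zero}  m≢0 = ⊥-elim (m≢0 refl)
  ≢0⇒ {suc m} _   = refl
c-Order n (suc k) (s≤s ())

-- The empty permutation, for which c 0 0 = 1, is left out.
C D A⁺ : X.Series
C zero    = Y.𝟎
C (suc n) = c (suc n)
D zero    = Y.𝟎
D (suc n) = d (suc n)
A⁺ zero    = Y.𝟎
A⁺ (suc n) = gfᵃ (suc n)

A⁺-split : A⁺ XS.≈ C XS.+ D
A⁺-split zero    k = refl
A⁺-split (suc n) k = trans (gfᵃ-split (suc n) k)
  (sym (cong₂ _+_ (c≡gfᶜ (suc n) k) (d≡gfᵈ (suc n) k)))

D-recurrence : D XS.≈ C XS.* A⁺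
D-recurrence zero    k = sym (Y.⊛-zeroˡ Y.𝟎 k)
D-recurrence (suc n) = begin
  d (suc n)
    ≈⟨ d≡gfᵈ (suc n) ⟩
  gfᵈ (suc n)
    ≈⟨ gfᵈ-recurrence n ⟩
  ∑Y.∑< n (λ i → gfᶜ (suc i) Y.⊛ gfᵃ (n ∸ i))
    ≈⟨ ∑Y.∑<-cong n (λ i i<n → YS.*-cong (YS.sym (c≡gfᶜ (suc i)))
         (YS.reflexive (A⁺-positive (n ∸ i) (ℕₚ.m<n⇒0<n∸m i<n)))) ⟩
  ∑Y.∑< n (λ i → c (suc i) Y.⊛ A⁺ (n ∸ i))
    ≈⟨ YS.+-identityʳ _ ⟨
  ∑Y.∑< n (λ i → c (suc i) Y.⊛ A⁺ (n ∸ i)) YS.+ Y.𝟎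
    -- The Cauchy product also has a term i = n; it vanishes because `A⁺ 0` is zero.
    ≈⟨ YS.+-congˡ (YS.trans (YS.*-congˡ (YS.reflexive (cong A⁺ (ℕₚ.n∸n≡0 n)))) (YS.zeroʳ (c (suc n)))) ⟨
  ∑Y.∑< n (λ i → c (suc i) Y.⊛ A⁺ (n ∸ i)) YS.+ c (suc n) Y.⊛ A⁺ (n ∸ n)
    ≈⟨ ∑Y.∑<-last n _ ⟨
  ∑Y.∑< (suc n) (λ i → c (suc i) Y.⊛ A⁺ (n ∸ i))
    ≈⟨ X.⊛-∑ n (C ∘ suc) A⁺ ⟨
  (C ∘ suc X.⊛ A⁺) n
    ≈⟨ YS.+-identityˡ _ ⟨
  Y.𝟎 YS.+ (C ∘ suc X.⊛ A⁺) n
    ≈⟨ YS.+-congʳ (YS.zeroˡ (A⁺ (suc n))) ⟨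
  (C X.⊛ A⁺) (suc n) ∎
  where
  open import Relation.Binary.Reasoning.Setoid YS.setoid
  A⁺-positive : ∀ m → 0 < m → gfᵃ m ≡ A⁺ m
  A⁺-positive (suc m) _ = refl

D-equation : D XS.≈ C XS.* C XS.+ C XS.* D
D-equation = XS.trans D-recurrence (XS.trans (XS.*-congˡ {C} A⁺-split) (XS.distribˡ C C D))

C-Order : OrderX 1 C
C-Order zero    k _ = refl
C-Order (suc n) = c-Order n

-- A bootstrap: knowing nothing about `A⁺`, the equation D = C A⁺ gives `D` order 1; then A⁺ = C + D
-- has order 1 too, and the same equation gives order 2.
D-Order : OrderX 2 D
D-Order n k k<2 = trans (D-recurrence n k) (OrderX-⊛ {f = C} {A⁺} C-Order A⁺-Order n k k<2)
  where
  A⁺-Order : OrderX 1 A⁺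
  A⁺-Order n k k<1 = trans (A⁺-split n k) (cong₂ _+_ (C-Order n k k<1)
    (trans (D-recurrence n k) (OrderX-⊛ {s = 1} {t = 0} {f = C} {A⁺} C-Order (λ _ _ ()) n k k<1)))

-- Unrolling k times produces the exponents 2, ..., k + 1 and a remainder of order k + 2 in y, which
-- is just beyond the coefficient k + 1 read here.
d-powers : ∀ n k → d (suc n) (suc k) ≡ ∑< k λ i → (C ^X suc (suc i)) (suc n) (suc k)
d-powers n k = begin
  d (suc n) (suc k)
    ≡⟨ Geometric.geometric X.series C D D-equation k (suc n) (suc k) ⟩
  ∑X.∑< k (λ i → C ^X suc (suc i)) (suc n) (suc k) + (C ^X k X.⊛ D) (suc n) (suc k)
    ≡⟨ cong₂ _+_ (∑-coeff₂ (upTo k) (λ i → C ^X suc (suc i)) (suc n) (suc k))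
         (OrderX-⊛ {f = C ^X k} {D} (OrderX-^ C-Order k) D-Order (suc n) (suc k)
           (subst₂ (λ a b → suc k < a + b) (sym (ℕₚ.*-identityʳ k)) refl (ℕₚ.≤-reflexive (ℕₚ.+-comm 2 k)))) ⟩
  ∑< k (λ i → (C ^X suc (suc i)) (suc n) (suc k)) + 0
    ≡⟨ ℕₚ.+-identityʳ _ ⟩
  ∑< k (λ i → (C ^X suc (suc i)) (suc n) (suc k)) ∎
  where open ≡-Reasoning

-- Coefficients of products, matched with the nested sums

∏ : ∀ {ℓ} → Vec Y.Series ℓ → Y.Series
∏ []       = Y.𝟏
∏ (f ∷ fs) = f Y.⊛ ∏ fs

at : ∀ {ℓ} → Vec Y.Series ℓ → Vec ℕ ℓ → ℕ
at []       []       = 1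
at (f ∷ fs) (k ∷ ks) = f k * at fs ks

-- Order 1 kills index 0 in every factor, so the positive indices of the box carry the whole
-- coefficient. The bound K is free because the target drops to k ∸ j in the recursion while the box
-- stays the same.
∏-coeff : ∀ {ℓ} {fs : Vec Y.Series ℓ} → VAll.All (Order 1) fs → ∀ {K} k → k ≤ K →
  ∏ fs k ≡ ∑ (box ℓ K) λ ks → when (vsum ks ≡ᵇ k) (at fs ks)
∏-coeff VAll.[] zero    _ = refl
∏-coeff VAll.[] (suc k) _ = refl
∏-coeff {suc ℓ} {f ∷ fs} (of VAll.∷ ofs) {K} k k≤K = begin
  (f Y.⊛ ∏ fs) k
    ≡⟨ Y.⊛-∑ k f (∏ fs) ⟩
  ∑< (suc k) (λ i → f i * ∏ fs (k ∸ i))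
    ≡⟨ ∑<-suc k _ ⟩
  f 0 * ∏ fs k + ∑< k (λ i → f (suc i) * ∏ fs (k ∸ suc i))
    ≡⟨ cong (λ x → x * ∏ fs k + ∑< k (λ i → f (suc i) * ∏ fs (k ∸ suc i))) (of 0 (s≤s z≤n)) ⟩
  ∑< k (λ i → f (suc i) * ∏ fs (k ∸ suc i))
    ≡⟨ ∑<-restrict _ k≤K ⟨
  ∑< K (λ i → when (suc i ≤ᵇ k) (f (suc i) * ∏ fs (k ∸ suc i)))
    ≡⟨ ∑-interval 1 K _ ⟨
  ∑ (interval 1 K) (λ j → when (j ≤ᵇ k) (f j * ∏ fs (k ∸ j)))
    ≡⟨ ∑-cong (interval 1 K) (λ j → trans (when-cong (j ≤ᵇ k) (expand j)) (∑-when (box ℓ K) (j ≤ᵇ k) _)) ⟩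
  ∑ (interval 1 K) (λ j → ∑ (box ℓ K) λ ks → when (j ≤ᵇ k) (when (vsum ks ≡ᵇ k ∸ j) (f j * at fs ks)))
    ≡⟨ ∑-cong (interval 1 K) (λ j → ∑-cong (box ℓ K) λ ks → sym (trans
         (cong (λ b → when b (f j * at fs ks)) (+≡ᵇ j (vsum ks) k)) (when-∧ (j ≤ᵇ k) _ _))) ⟩
  ∑ (interval 1 K) (λ j → ∑ (box ℓ K) λ ks → when (j + vsum ks ≡ᵇ k) (f j * at fs ks))
    ≡⟨ ∑-vecs ℓ (interval 1 K) _ ⟨
  ∑ (box (suc ℓ) K) (λ ks → when (vsum ks ≡ᵇ k) (at (f ∷ fs) ks)) ∎
  where
  open ≡-Reasoning
  expand : ∀ j → f j * ∏ fs (k ∸ j) ≡ ∑ (box ℓ K) λ ks → when (vsum ks ≡ᵇ k ∸ j) (f j * at fs ks)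
  expand j = trans (cong (f j *_) (∏-coeff ofs (k ∸ j) (ℕₚ.≤-trans (ℕₚ.m∸n≤m k j) k≤K)))
    (trans (∑-*ˡ (box ℓ K) (f j) _) (∑-cong (box ℓ K) λ ks → when-*ˡ (vsum ks ≡ᵇ k ∸ j) (f j) _))

-- An instance of `∏-coeff` with r equal factors; their order is 1 because n is positive.
inner≡^ : ∀ r n → 1 ≤ n → ∀ k → inner r n k ≡ (c n ^Y r) k
inner≡^ r n@(suc n′) _ k = begin
  inner r n k
    ≡⟨ ∑-filter (box r k) _ _ ⟩
  ∑ (box r k) (λ ks → when (vsum ks ≡ᵇ k) (vprod (Vec.map (c n) ks)))
    ≡⟨ ∑-cong (box r k) (λ ks → when-cong (vsum ks ≡ᵇ k) (at-replicate ks)) ⟨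
  ∑ (box r k) (λ ks → when (vsum ks ≡ᵇ k) (at (replicate r (c n)) ks))
    ≡⟨ ∏-coeff (orders r) k ℕₚ.≤-refl ⟨
  ∏ (replicate r (c n)) k
    ≡⟨ ∏-replicate r k ⟩
  (c n ^Y r) k ∎
  where
  open ≡-Reasoning
  at-replicate : ∀ {r} (ks : Vec ℕ r) → at (replicate r (c n)) ks ≡ vprod (Vec.map (c n) ks)
  at-replicate []       = refl
  at-replicate (k ∷ ks) = cong (c n k *_) (at-replicate ks)
  orders : ∀ r → VAll.All (Order 1) (replicate r (c n))
  orders zero    = VAll.[]
  orders (suc r) = c-Order n′ VAll.∷ orders r
  ∏-replicate : ∀ r → ∏ (replicate r (c n)) YS.≈ c n ^Y r
  ∏-replicate zero    k = refl
  ∏-replicate (suc r) k = YS.*-congˡ {c n} (∏-replicate r) k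

c^-Order : ∀ r n → 1 ≤ n → Order r (c n ^Y r)
c^-Order r (suc n) _ = subst (λ t → Order t (c (suc n) ^Y r)) (ℕₚ.*-identityʳ r) (Order-^ (c-Order n) r)

c-powers : ∀ {ℓ} → Vec ℕ ℓ → Vec ℕ ℓ → Vec Y.Series ℓ
c-powers = zipWith (λ r n → c n ^Y r)

-- The guard agrees with divisibility: (c n)^r has order r in y, so the coefficients with k < r that
-- the guard removes are zero.
at-c-powers : ∀ {ℓ} (rs : Vec ℕ ℓ) {ns} → VAll.All (1 ≤_) ns → ∀ ks →
  when (pointwiseGeq ks rs) (prodInner rs ns ks) ≡ at (c-powers rs ns) ks
at-c-powers []       VAll.[] [] = refl
at-c-powers (r ∷ rs) {n ∷ ns} (n≥1 VAll.∷ ns≥1) (k ∷ ks) = begin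
  when ((r ≤ᵇ k) ∧ pointwiseGeq ks rs) (inner r n k * prodInner rs ns ks)
    ≡⟨ when-∧ (r ≤ᵇ k) _ _ ⟩
  when (r ≤ᵇ k) (when (pointwiseGeq ks rs) (inner r n k * prodInner rs ns ks))
    ≡⟨ when-cong (r ≤ᵇ k) (when-*ˡ (pointwiseGeq ks rs) (inner r n k) _) ⟨
  when (r ≤ᵇ k) (inner r n k * when (pointwiseGeq ks rs) (prodInner rs ns ks))
    ≡⟨ cong₂ (λ x y → when (r ≤ᵇ k) (x * y)) (inner≡^ r n n≥1 k) (at-c-powers rs ns≥1 ks) ⟩
  when (r ≤ᵇ k) ((c n ^Y r) k * at (c-powers rs ns) ks)
    ≡⟨ when-redundant ⟩
  (c n ^Y r) k * at (c-powers rs ns) ks ∎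
  where
  open ≡-Reasoning
  when-redundant : when (r ≤ᵇ k) ((c n ^Y r) k * at (c-powers rs ns) ks) ≡
                   (c n ^Y r) k * at (c-powers rs ns) ks
  when-redundant with r ≤ᵇ k in eq
  ... | true  = refl
  ... | false = sym (cong (_* at (c-powers rs ns) ks)
    (c^-Order r n n≥1 k (ℕₚ.≰⇒> λ r≤k → subst T eq (ℕₚ.≤⇒≤ᵇ r≤k))))

c-powers-Order : ∀ {ℓ} {rs ns : Vec ℕ ℓ} → VAll.All (1 ≤_) rs → VAll.All (1 ≤_) ns →
  VAll.All (Order 1) (c-powers rs ns)
c-powers-Order VAll.[] VAll.[] = VAll.[]
c-powers-Order {rs = r ∷ _} {n ∷ _} (r≥1 VAll.∷ rs≥1) (n≥1 VAll.∷ ns≥1) =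
  (λ k k<1 → c^-Order r n n≥1 k (ℕₚ.<-≤-trans k<1 r≥1)) VAll.∷ c-powers-Order rs≥1 ns≥1

sum-over-ks : ∀ {ℓ} {rs ns : Vec ℕ ℓ} → VAll.All (1 ≤_) rs → VAll.All (1 ≤_) ns → ∀ k a →
  sumOver (box ℓ k) (λ ks → (vsum ks ≡ᵇ k) ∧ pointwiseGeq ks rs) (λ ks → a * prodInner rs ns ks)
  ≡ a * ∏ (c-powers rs ns) k
sum-over-ks {ℓ} {rs} {ns} rs≥1 ns≥1 k a = begin
  sumOver (box ℓ k) (λ ks → (vsum ks ≡ᵇ k) ∧ pointwiseGeq ks rs) (λ ks → a * prodInner rs ns ks)
    ≡⟨ ∑-filter (box ℓ k) _ _ ⟩
  ∑ (box ℓ k) (λ ks → when ((vsum ks ≡ᵇ k) ∧ pointwiseGeq ks rs) (a * prodInner rs ns ks))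
    ≡⟨ ∑-cong (box ℓ k) (λ ks → trans (sym (when-*ˡ ((vsum ks ≡ᵇ k) ∧ pointwiseGeq ks rs) a _))
         (cong (a *_) (trans (when-∧ (vsum ks ≡ᵇ k) _ _) (when-cong (vsum ks ≡ᵇ k) (at-c-powers rs ns≥1 ks))))) ⟩
  ∑ (box ℓ k) (λ ks → a * when (vsum ks ≡ᵇ k) (at (c-powers rs ns) ks))
    ≡⟨ ∑-*ˡ (box ℓ k) a _ ⟨
  a * ∑ (box ℓ k) (λ ks → when (vsum ks ≡ᵇ k) (at (c-powers rs ns) ks))
    ≡⟨ cong (a *_) (∏-coeff (c-powers-Order rs≥1 ns≥1) k ℕₚ.≤-refl) ⟨
  a * ∏ (c-powers rs ns) k ∎
  where open ≡-Reasoning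

Q : ℕ → X.Series
Q m = X.monomial (c m) m

open Multinomial X.series Q using (powers; H; G; H-zero; multinomial-tail)
open import Algebra.Definitions.RawMonoid XS.+-rawMonoid using () renaming (_×_ to _×X_)
open import Algebra.Definitions.RawMonoid YS.+-rawMonoid using () renaming (_×_ to _×Y_)

Q-^ : ∀ m r → Q m ^X r XS.≈ X.monomial (c m ^Y r) (r * m)
Q-^ m zero    zero    = YS.refl
Q-^ m zero    (suc n) = YS.refl
Q-^ m (suc r) = XS.trans (XS.*-congˡ {Q m} (Q-^ m r)) (X.monomial-* (c m) m (c m ^Y r) (r * m))

-- A product of powers of monomials in x is a monomial of degree Σ rᵢ nᵢ; reading its coefficient at
-- n produces the condition `dot rs ns ≡ᵇ n`.
powers-monomial : ∀ {ℓ} (rs ns : Vec ℕ ℓ) → powers rs ns XS.≈ X.monomial (∏ (c-powers rs ns)) (dot rs ns)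
powers-monomial []       []       zero    = YS.refl
powers-monomial []       []       (suc n) = YS.refl
powers-monomial (r ∷ rs) (n ∷ ns) = XS.trans (XS.*-cong (Q-^ n r) (powers-monomial rs ns))
  (X.monomial-* (c n ^Y r) (r * n) (∏ (c-powers rs ns)) (dot rs ns))

powers-coeff : ∀ {ℓ} a (rs ns : Vec ℕ ℓ) n k →
  (a ×X powers rs ns) n k ≡ when (dot rs ns ≡ᵇ n) (a * ∏ (c-powers rs ns) k)
powers-coeff a rs ns n k = begin
  (a ×X powers rs ns) n k                                  ≡⟨ X.×-coeff a (powers rs ns) n k ⟩
  (a ×Y powers rs ns n) k                                  ≡⟨ Y.×-coeff a (powers rs ns n) k ⟩
  a × powers rs ns n k                                     ≡⟨ ×≡* a _ ⟩
  a * powers rs ns n k                                     ≡⟨ cong (a *_) (powers-monomial rs ns n k) ⟩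
  a * X.monomial (∏ (c-powers rs ns)) (dot rs ns) n k      ≡⟨ cong (a *_) (Y.when-coeff (dot rs ns ≡ᵇ n) _ k) ⟩
  a * when (dot rs ns ≡ᵇ n) (∏ (c-powers rs ns) k)         ≡⟨ when-*ˡ (dot rs ns ≡ᵇ n) a _ ⟩
  when (dot rs ns ≡ᵇ n) (a * ∏ (c-powers rs ns) k)         ∎
  where open ≡-Reasoning

interval-≥ : ∀ a b → All (a ≤_) (interval a b)
interval-≥ a b = LAllₚ.map⁺ (LAll.universal (ℕₚ.m≤m+n a) (upTo (suc b ∸ a)))

strictlyIncreasing-0 : ∀ {ℓ} {ns : Vec ℕ ℓ} → VAll.All (1 ≤_) ns →
  strictlyIncreasing (0 ∷ ns) ≡ strictlyIncreasing ns
strictlyIncreasing-0 VAll.[] = refl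
strictlyIncreasing-0 (s≤s _ VAll.∷ _) = refl

-- The parameters r₀ = r and N = n reproduce the boxes of `rhs`, and the bound b = 0 lies below all
-- the sizes allowed there.
H-coeff : ∀ ℓ r n k → H r n ℓ r 0 n k ≡
  sumOver (box ℓ r) (λ rs → vsum rs ≡ᵇ r) (λ rs →
    sumOver (box ℓ n) (λ ns → strictlyIncreasing ns ∧ (dot rs ns ≡ᵇ n)) (λ ns →
      sumOver (box ℓ k) (λ ks → (vsum ks ≡ᵇ k) ∧ pointwiseGeq ks rs) (λ ks →
        multinomial rs * prodInner rs ns ks)))
H-coeff ℓ r n k = begin
  H r n ℓ r 0 n k
    ≡⟨ ∑-coeff₂ (box ℓ r) (λ rs → ∑X.when (vsum rs ≡ᵇ r) (terms rs)) n k ⟩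
  _ ≡⟨ ∑-vecs-congᴬ ℓ (interval-≥ 1 r) (λ rs rs≥1 → trans
         (when-coeff₂ (vsum rs ≡ᵇ r) (terms rs) n k) (when-cong (vsum rs ≡ᵇ r) (over-ns rs rs≥1))) ⟩
  _ ≡⟨ ∑-filter (box ℓ r) _ _ ⟨
  _ ∎
  where
  open ≡-Reasoning
  term : Vec ℕ ℓ → Vec ℕ ℓ → X.Series
  term rs ns = ∑X.when (strictlyIncreasing (0 ∷ ns)) (multinomial rs ×X powers rs ns)
  terms : Vec ℕ ℓ → X.Series
  terms rs = ∑X.∑ (box ℓ n) (term rs)
  over-ns : ∀ rs → VAll.All (1 ≤_) rs → terms rs n k ≡
    sumOver (box ℓ n) (λ ns → strictlyIncreasing ns ∧ (dot rs ns ≡ᵇ n)) (λ ns →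
      sumOver (box ℓ k) (λ ks → (vsum ks ≡ᵇ k) ∧ pointwiseGeq ks rs) (λ ks →
        multinomial rs * prodInner rs ns ks))
  over-ns rs rs≥1 = begin
    _ ≡⟨ ∑-coeff₂ (box ℓ n) (term rs) n k ⟩
    _ ≡⟨ ∑-vecs-congᴬ ℓ (interval-≥ 1 n) (λ ns ns≥1 → begin
           term rs ns n k
             ≡⟨ when-coeff₂ (strictlyIncreasing (0 ∷ ns)) (multinomial rs ×X powers rs ns) n k ⟩
           when (strictlyIncreasing (0 ∷ ns)) ((multinomial rs ×X powers rs ns) n k)
             ≡⟨ cong₂ when (strictlyIncreasing-0 ns≥1) (trans (powers-coeff (multinomial rs) rs ns n k)
                  (when-cong (dot rs ns ≡ᵇ n) (sym (sum-over-ks rs≥1 ns≥1 k (multinomial rs))))) ⟩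
           when (strictlyIncreasing ns) (when (dot rs ns ≡ᵇ n) _)
             ≡⟨ when-∧ (strictlyIncreasing ns) (dot rs ns ≡ᵇ n) _ ⟨
           when (strictlyIncreasing ns ∧ (dot rs ns ≡ᵇ n)) _ ∎) ⟩
    _ ≡⟨ ∑-filter (box ℓ n) _ _ ⟨
    _ ∎

-- `G r n 0` is the truncation of `C` at degree n in x: a finite sum, to which the multinomial
-- theorem applies.
G≈C : ∀ r n i → i ≤ n → G r n 0 i YS.≈ C i
G≈C r n i i≤n = begin
  G r n 0 i
    ≈⟨ X.∑-coeff (interval 1 n) _ i ⟩
  ∑Y.∑ (interval 1 n) (λ y → ∑X.when (0 <ᵇ y) (Q y) i)
    ≈⟨ ∑Y.∑-interval 1 n _ ⟩
  ∑Y.∑< n (λ j → ∑Y.when (suc j ≡ᵇ i) (c (suc j)))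
    ≈⟨ pick i i≤n ⟩
  C i ∎
  where
  open import Relation.Binary.Reasoning.Setoid YS.setoid
  pick : ∀ i → i ≤ n → ∑Y.∑< n (λ j → ∑Y.when (suc j ≡ᵇ i) (c (suc j))) YS.≈ C i
  pick zero    _   = ∑Y.∑-zero (upTo n) λ _ → YS.refl
  pick (suc i) i<n = ∑Y.∑<-δ n i (c ∘ suc) i<n

^-cong-≤ : ∀ {f g : X.Series} {n} → (∀ i → i ≤ n → f i YS.≈ g i) → ∀ r i → i ≤ n → (f ^X r) i YS.≈ (g ^X r) i
^-cong-≤ f≈g zero    i i≤n = YS.refl
^-cong-≤ f≈g (suc r) i i≤n = X.⊛-cong-≤ i (λ j j≤i → f≈g j (ℕₚ.≤-trans j≤i i≤n))
  (λ j j≤i → ^-cong-≤ f≈g r j (ℕₚ.≤-trans j≤i i≤n))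

C^-coeff : ∀ r n k → (C ^X suc r) n k ≡ ∑ (interval 1 (suc r)) λ ℓ → H (suc r) n ℓ (suc r) 0 n k
C^-coeff r n k = begin
  (C ^X suc r) n k
    ≡⟨ ^-cong-≤ (G≈C (suc r) n) (suc r) n ℕₚ.≤-refl k ⟨
  (G (suc r) n 0 ^X suc r) n k
    -- The bound r + 2 lets ℓ run from 0 to the exponent r + 1.
    ≡⟨ multinomial-tail (suc r) n (suc (suc r)) 0 ℕₚ.≤-refl ℕₚ.≤-refl z≤n n k ⟨
  ∑X.∑< (suc (suc r)) (λ ℓ → H (suc r) n ℓ (suc r) 0) n k
    ≡⟨ ∑-coeff₂ (upTo (suc (suc r))) (λ ℓ → H (suc r) n ℓ (suc r) 0) n k ⟩
  ∑< (suc (suc r)) (λ ℓ → H (suc r) n ℓ (suc r) 0 n k)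
    ≡⟨ ∑<-suc (suc r) (λ ℓ → H (suc r) n ℓ (suc r) 0 n k) ⟩
  H (suc r) n 0 (suc r) 0 n k + ∑< (suc r) (λ ℓ → H (suc r) n (suc ℓ) (suc r) 0 n k)
    -- The term ℓ = 0 contributes only to the power 0, whereas the exponent here is r + 1.
    ≡⟨ cong₂ _+_ (H-zero (suc r) n (suc r) 0 n k) (sym (∑-interval 1 (suc r) _)) ⟩
  ∑ (interval 1 (suc r)) (λ ℓ → H (suc r) n ℓ (suc r) 0 n k) ∎
  where open ≡-Reasoning

theorem9 : (n k : ℕ) → 1 ≤ n → 1 ≤ k → d n k ≡ rhs n k
theorem9 (suc n) (suc k) _ _ = begin
  d (suc n) (suc k)
    ≡⟨ d-powers n k ⟩
  ∑< k (λ i → (C ^X suc (suc i)) (suc n) (suc k))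
    ≡⟨ ∑-cong (upTo k) (λ i → trans (C^-coeff (suc i) (suc n) (suc k))
         (∑-cong (interval 1 (suc (suc i))) λ ℓ → H-coeff ℓ (suc (suc i)) (suc n) (suc k))) ⟩
  _ ≡⟨ ∑-interval 2 (suc k) _ ⟨
  rhs (suc n) (suc k) ∎
  where open ≡-Reasoning
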